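{- As formal power series in $y,z$ with coefficients in $\mathbb{Z}[x]$, $$\sum_{n\ge 0}\sum_{k\ge 0}C(\Phi^n_k,x)\,y^nz^k=\frac{y}{1-y^2z\left(1+yz\left(1+xy^2z\right)\right)}.$$
   Context: A subword of a word is a block of consecutive letters. A binary word (over $\{0,1\}$) of length $n\ge 1$ is Padovan if it starts and ends with $0$, contains no subword $00$, and contains no subword $111$. For $n\ge1$ and $\lfloor n/2\rfloor\le k\le\lfloor(2n-2)/3\rfloor$, the weighted Padovan graph $\Phi^n_k$ is the simple graph whose vertices are all Padovan words of length $n$ with exactly $k$ letters $1$; two vertices are adjacent if one can be obtained from the other by replacing exactly one subword $01$ with $10$. The cube polynomial of a finite graph $G$ is $C(G,x)=\sum_{m\ge0}c_m(G)x^m$, where $c_m(G)$ is the number of induced subgraphs of $G$ isomorphic to the $m$-dimensional hypercube $Q_m$ (so $c_0(G)=|V(G)|$, $c_1(G)=|E(G)|$). Convention: for pairs $(n,k)$ of nonnegative integers with $n=0$ or $k$ outside the range $\lfloor n/2\rfloor\le k\le\lfloor(2n-2)/3\rfloor$, $\Phi^n_k$ is the empty graph and $C(\Phi^n_k,x)=0$. -}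

module Defs where

open import Level using (0ℓ)
open import Algebra.Bundles.Raw using (RawRing)
import Algebra.Definitions.RawSemiring as RawSemiringDefinitions
open import Data.Bool.Base using (false; _∧_; if_then_else_)
open import Data.Digit using (Bit; 0b; 1b)
open import Data.Empty using (⊥)
open import Data.Fin.Base as Fin using (Fin; zero; suc; toℕ; finToFun; funToFin)
import Data.Fin.Properties as Finₚ
open import Data.Fin.Subset using (Subset; _∈_)
open import Data.Fin.Subset.Properties using (_∈?_)
open import Data.Integer.Base as ℤ using (ℤ; 0ℤ; 1ℤ; +_)
import Data.Integer.Properties as ℤₚ
open import Data.Irrelevant using ([_])
open import Data.List.Base as List using (List; []; _∷_)
open import Data.List.Relation.Binary.Infix.Heterogeneous using (Infix)
open import Data.List.Relation.Binary.Infix.Heterogeneous.Properties using (infix?)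
open import Data.Maybe.Base using (just)
import Data.Maybe.Properties as Maybeₚ
open import Data.Nat.Base as ℕ using (ℕ; zero; suc; _≤_; _<_; _≡ᵇ_; _∸_; _/_)
import Data.Nat.Properties as ℕₚ
open import Data.Product.Base using (Σ-syntax; ∃; _×_; _,_; proj₁; proj₂)
open import Data.Refinement using (Refinement; Refinement-syntax; _,_; value)
open import Data.Sum.Base as Sum using (_⊎_; [_,_]′)
open import Data.Vec.Base as Vec using (Vec; []; _∷_; toList)
open import Data.Vec.Functional using (Vector)
open import Function.Base using (_∘_; id)
open import Function.Bundles using (_↔_; Inverse; mk↔ₛ′; _⇔_; Equivalence; mk⇔)
open import Function.Construct.Composition using (_↔-∘_)
open import Relation.Binary.Core using (Rel)
open import Relation.Binary.Definitions using (Symmetric) renaming (Decidable to Decidable₂)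
open import Relation.Binary.PropositionalEquality
  using (_≡_; _≢_; refl; sym; trans; cong; cong₂; subst; subst₂; _≗_)
open import Relation.Nullary using (¬_; Dec; yes; no; does; contradiction; contradiction-irr)
open import Relation.Nullary.Decidable using (map′; _×-dec_; _→-dec_; _⊎-dec_; ¬?)
open import Relation.Unary using (Pred; Decidable)

Finite : Set → Set
Finite A = Σ[ n ∈ ℕ ] (A ↔ Fin n)

card : {A : Set} → Finite A → ℕ
card = proj₁

refinement≡ : {A : Set} {P : A → Set} {a b : [ x ∈ A ∣ P x ]} →
              value a ≡ value b → a ≡ b
refinement≡ {a = _ , _} {b = _ , _} refl = refl

fin-refinement : ∀ n {P : Pred (Fin n) 0ℓ} → Decidable P →
                 Finite [ i ∈ Fin n ∣ P i ]
fin-refinement zero P? = 0 , mk↔ₛ′ (λ { (() , _) }) (λ ()) (λ ()) (λ { (() , _) })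
fin-refinement (suc n) {P} P? with P? zero | fin-refinement n {P ∘ suc} (P? ∘ suc)
... | yes p | m , φ = suc m , mk↔ₛ′ f g fg gf
  where
  open Inverse φ
  f : [ i ∈ Fin (suc n) ∣ P i ] → Fin (suc m)
  f (zero  , _) = zero
  f (suc i , q) = suc (to (i , q))
  g : Fin (suc m) → [ i ∈ Fin (suc n) ∣ P i ]
  g zero    = zero , [ p ]
  g (suc j) = suc (value (from j)) , Refinement.proof (from j)
  fg : ∀ j → f (g j) ≡ j
  fg zero    = refl
  fg (suc j) = cong suc (strictlyInverseˡ j)
  gf : ∀ a → g (f a) ≡ a
  gf (zero  , _) = refl
  gf (suc i , q) = refinement≡ (cong (suc ∘ value) (strictlyInverseʳ (i , q)))
... | no ¬p | m , φ = m , mk↔ₛ′ f g fg gf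
  where
  open Inverse φ
  f : [ i ∈ Fin (suc n) ∣ P i ] → Fin m
  f (zero  , [ q ]) = contradiction-irr q ¬p
  f (suc i , q)     = to (i , q)
  g : Fin m → [ i ∈ Fin (suc n) ∣ P i ]
  g j = suc (value (from j)) , Refinement.proof (from j)
  fg : ∀ j → f (g j) ≡ j
  fg j = strictlyInverseˡ j
  gf : ∀ a → g (f a) ≡ a
  gf (zero  , [ q ]) = contradiction-irr q ¬p
  gf (suc i , q)     = refinement≡ (cong (suc ∘ value) (strictlyInverseʳ (i , q)))

finite-refinement : {A : Set} {P : Pred A 0ℓ} → Finite A → Decidable P →
                    Finite [ a ∈ A ∣ P a ]
finite-refinement {A} {P} (n , φ) P? =
  let m , ψ = fin-refinement n (P? ∘ from) in m , ψ ↔-∘ reindex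
  where
  open Inverse φ
  reindex : [ a ∈ A ∣ P a ] ↔ [ i ∈ Fin n ∣ P (from i) ]
  reindex = mk↔ₛ′
    (λ { (a , [ p ]) → to a , [ subst P (sym (strictlyInverseʳ a)) p ] })
    (λ { (i , p) → from i , p })
    (λ { (i , _) → refinement≡ (strictlyInverseˡ i) })
    (λ { (a , _) → refinement≡ (strictlyInverseʳ a) })

finite-vec : ∀ b n → Finite (Vec (Fin b) n)
finite-vec b n = b ℕ.^ n , mk↔ₛ′
  (funToFin ∘ Vec.lookup)
  (Vec.tabulate ∘ finToFun)
  (λ i → trans (funToFin-cong {n} (lookup∘tabulate (finToFun i))) (Finₚ.funToFin-finToFin {n} {b} i))
  (λ v → trans (tabulate-cong (Finₚ.finToFun-funToFin (Vec.lookup v))) (tabulate∘lookup v))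
  where
  open import Data.Vec.Properties using (lookup∘tabulate; tabulate-cong; tabulate∘lookup)
  funToFin-cong : ∀ {k} {f g : Fin k → Fin b} → f ≗ g → funToFin f ≡ funToFin g
  funToFin-cong {zero}  f≗g = refl
  funToFin-cong {suc k} f≗g = cong₂ Fin.combine (f≗g zero) (funToFin-cong (f≗g ∘ suc))

finite-subset : ∀ n → Finite (Subset n)
finite-subset n = 2 ℕ.^ n , (proj₂ (finite-vec 2 n) ↔-∘ bits)
  where
  open import Data.Vec.Properties using (map-∘; map-cong; map-id)
  open Inverse (Finₚ.2↔Bool)
  bits : Subset n ↔ Vec (Fin 2) n
  bits = mk↔ₛ′ (Vec.map from) (Vec.map to)
    (λ v → trans (sym (map-∘ from to v)) (trans (map-cong strictlyInverseʳ v) (map-id v)))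
    (λ v → trans (sym (map-∘ to from v)) (trans (map-cong strictlyInverseˡ v) (map-id v)))

record Graph : Set₁ where
  infix 4 _~_ _~?_
  field
    V        : Set
    _~_      : Rel V 0ℓ
    ~-irrefl : ∀ {v} → ¬ v ~ v
    ~-sym    : Symmetric _~_
    _~?_     : Decidable₂ _~_
    finite   : Finite V

  order : ℕ
  order = card finite

  index : V → Fin order
  index = Inverse.to (proj₂ finite)

open Graph using (V; order)

infix 4 _≅_ _≅?_

_≅_ : Graph → Graph → Set
G ≅ H = Σ[ φ ∈ (V G ↔ V H) ]
  (∀ u v → Graph._~_ G u v ⇔ Graph._~_ H (Inverse.to φ u) (Inverse.to φ v))

_≅?_ : ∀ G H → Dec (G ≅ H)
G ≅? H = map′ sound complete
  (Finₚ.any? λ c → Finₚ.any? λ d → isIso? (finToFun c) (finToFun d))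
  where
  module G = Graph G
  module H = Graph H
  module γ = Inverse (proj₂ G.finite)
  module η = Inverse (proj₂ H.finite)

  record IsIso (f : Fin G.order → Fin H.order) (g : Fin H.order → Fin G.order) : Set where
    constructor mkIsIso
    eta-equality
    field
      fg       : ∀ j → f (g j) ≡ j
      gf       : ∀ i → g (f i) ≡ i
      preserve : ∀ i j → γ.from i G.~ γ.from j → η.from (f i) H.~ η.from (f j)
      reflect  : ∀ i j → η.from (f i) H.~ η.from (f j) → γ.from i G.~ γ.from j

  isIso? : ∀ f g → Dec (IsIso f g)
  isIso? f g = map′ (λ (p , q , r , s) → mkIsIso p q r s)
    (λ (mkIsIso p q r s) → p , q , r , s)
    (  Finₚ.all? (λ j → f (g j) Finₚ.≟ j)
    ×-dec Finₚ.all? (λ i → g (f i) Finₚ.≟ i)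
    ×-dec Finₚ.all? (λ i → Finₚ.all? λ j →
            (γ.from i G.~? γ.from j) →-dec (η.from (f i) H.~? η.from (f j)))
    ×-dec Finₚ.all? (λ i → Finₚ.all? λ j →
            (η.from (f i) H.~? η.from (f j)) →-dec (γ.from i G.~? γ.from j)))

  sound : (∃ λ c → ∃ λ d → IsIso (finToFun c) (finToFun d)) → G ≅ H
  sound (c , d , mkIsIso fg gf preserve reflect) = φ , λ u v → mk⇔
      (λ u~v → preserve (γ.to u) (γ.to v)
        (subst₂ G._~_ (sym (γ.strictlyInverseʳ u)) (sym (γ.strictlyInverseʳ v)) u~v))
      (λ φu~φv → subst₂ G._~_ (γ.strictlyInverseʳ u) (γ.strictlyInverseʳ v)
        (reflect (γ.to u) (γ.to v) φu~φv))
    where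
    φ : V G ↔ V H
    φ = mk↔ₛ′ (η.from ∘ finToFun c ∘ γ.to) (γ.from ∘ finToFun d ∘ η.to)
      (λ y → trans (cong (η.from ∘ finToFun c) (γ.strictlyInverseˡ _))
               (trans (cong η.from (fg (η.to y))) (η.strictlyInverseʳ y)))
      (λ x → trans (cong (γ.from ∘ finToFun d) (η.strictlyInverseˡ _))
               (trans (cong γ.from (gf (γ.to x))) (γ.strictlyInverseʳ x)))

  complete : G ≅ H → ∃ λ c → ∃ λ d → IsIso (finToFun c) (finToFun d)
  complete (φ , adj) = funToFin f , funToFin g , mkIsIso
    (λ j → trans (f≗ _) (trans (cong f (g≗ j)) (fg j)))
    (λ i → trans (g≗ _) (trans (cong g (f≗ i)) (gf i)))
    (λ i j p → subst₂ H._~_ (sym (from-f i)) (sym (from-f j)) (Equivalence.to (adj _ _) p))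
    (λ i j p → Equivalence.from (adj _ _) (subst₂ H._~_ (from-f i) (from-f j) p))
    where
    module φ = Inverse φ
    f : Fin G.order → Fin H.order
    f = η.to ∘ φ.to ∘ γ.from
    g : Fin H.order → Fin G.order
    g = γ.to ∘ φ.from ∘ η.from
    f≗ : finToFun (funToFin f) ≗ f
    f≗ = Finₚ.finToFun-funToFin f
    g≗ : finToFun (funToFin g) ≗ g
    g≗ = Finₚ.finToFun-funToFin g
    fg : ∀ j → f (g j) ≡ j
    fg j = trans (cong (η.to ∘ φ.to) (γ.strictlyInverseʳ _))
             (trans (cong η.to (φ.strictlyInverseˡ _)) (η.strictlyInverseˡ j))
    gf : ∀ i → g (f i) ≡ i
    gf i = trans (cong (γ.to ∘ φ.from) (η.strictlyInverseʳ _))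
             (trans (cong γ.to (φ.strictlyInverseʳ _)) (γ.strictlyInverseˡ i))
    from-f : ∀ i → η.from (finToFun (funToFin f) i) ≡ φ.to (γ.from i)
    from-f i = trans (cong η.from (f≗ i)) (η.strictlyInverseʳ _)

-- Vertex subsets are given through the numbering of V; they correspond
-- one-to-one to the induced subgraphs.
induced : (G : Graph) → Subset (order G) → Graph
induced G S = record
  { V        = [ v ∈ V G ∣ G.index v ∈ S ]
  ; _~_      = λ u v → value u G.~ value v
  ; ~-irrefl = G.~-irrefl
  ; ~-sym    = G.~-sym
  ; _~?_     = λ u v → value u G.~? value v
  ; finite   = finite-refinement G.finite (λ v → G.index v ∈? S)
  }
  where module G = Graph G

emptyGraph : Graph
emptyGraph = record
  { V        = Fin 0
  ; _~_      = λ _ _ → ⊥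
  ; ~-irrefl = id
  ; ~-sym    = id
  ; _~?_     = λ _ _ → no id
  ; finite   = 0 , mk↔ₛ′ id id (λ _ → refl) (λ _ → refl)
  }

-- Two bit vectors related by DifferOnce differ in exactly one coordinate.
data DifferOnce : ∀ {m} → Rel (Vec Bit m) 0ℓ where
  here  : ∀ {m a b} {u : Vec Bit m} → a ≢ b → DifferOnce (a ∷ u) (b ∷ u)
  there : ∀ {m a} {u v : Vec Bit m} → DifferOnce u v → DifferOnce (a ∷ u) (a ∷ v)

differOnce-irrefl : ∀ {m} {u : Vec Bit m} → ¬ DifferOnce u u
differOnce-irrefl (here a≢a) = a≢a refl
differOnce-irrefl (there d)  = differOnce-irrefl d

differOnce-sym : ∀ {m} → Symmetric (DifferOnce {m})
differOnce-sym (here a≢b) = here (a≢b ∘ sym)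
differOnce-sym (there d)  = there (differOnce-sym d)

differOnce? : ∀ {m} → Decidable₂ (DifferOnce {m})
differOnce? [] [] = no λ ()
differOnce? (a ∷ u) (b ∷ v) with a Finₚ.≟ b
... | yes refl = map′ there
                   (λ { (here a≢a) → contradiction refl a≢a ; (there d) → d })
                   (differOnce? u v)
... | no a≢b   = map′ (λ { refl → here a≢b })
                   (λ { (here _) → refl ; (there _) → contradiction refl a≢b })
                   (≡-dec Finₚ._≟_ u v)
  where open import Data.Vec.Properties using (≡-dec)

Q : ℕ → Graph
Q m = record
  { V        = Vec Bit m
  ; _~_      = DifferOnce
  ; ~-irrefl = differOnce-irrefl
  ; ~-sym    = differOnce-sym
  ; _~?_     = differOnce?
  ; finite   = finite-vec 2 m
  }

inducedCubes : (m : ℕ) (G : Graph) →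
               Finite [ S ∈ Subset (order G) ∣ induced G S ≅ Q m ]
inducedCubes m G = finite-refinement (finite-subset (order G)) (λ S → induced G S ≅? Q m)

c : ℕ → Graph → ℕ
c m G = card (inducedCubes m G)

c-vanish : ∀ {m} G → order G ≤ m → c m G ≡ 0
c-vanish {m} G N≤m = empty (c m G) (Inverse.from (proj₂ (inducedCubes m G)))
  where
  n<2^n : ∀ n → n < 2 ℕ.^ n
  n<2^n zero    = ℕₚ.≤-refl
  n<2^n (suc n) = ℕₚ.+-mono-≤ (ℕₚ.m^n>0 2 n)
    (subst (n <_) (sym (ℕₚ.+-identityʳ _)) (n<2^n n))

  noCube : ∀ S → ¬ (induced G S ≅ Q m)
  noCube S (φ , _) = ℕₚ.<⇒≱ (ℕₚ.≤-<-trans N≤m (n<2^n m)) (Finₚ.injective⇒≤ f-injective)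
    where
    module φ = Inverse φ
    module q = Inverse (proj₂ (finite-vec 2 m))
    module γ = Inverse (proj₂ (Graph.finite G))
    f : Fin (2 ℕ.^ m) → Fin (order G)
    f = γ.to ∘ value ∘ φ.from ∘ q.from
    f-injective : ∀ {i j} → f i ≡ f j → i ≡ j
    f-injective {i} {j} fi≡fj = trans (sym (q.strictlyInverseˡ i))
      (trans (cong q.to (trans (sym (φ.strictlyInverseˡ _))
        (trans (cong φ.to (refinement≡ (trans (sym (γ.strictlyInverseʳ _))
          (trans (cong γ.from fi≡fj) (γ.strictlyInverseʳ _)))))
        (φ.strictlyInverseˡ _)))) (q.strictlyInverseˡ j))

  empty : ∀ n → (Fin n → [ S ∈ Subset (order G) ∣ induced G S ≅ Q m ]) → n ≡ 0
  empty zero    _ = refl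
  empty (suc n) h with h zero
  ... | S , [ iso ] = contradiction-irr iso (noCube S)

record Polynomial : Set where
  field
    coeff  : ℕ → ℤ
    bound  : ℕ
    vanish : ∀ {i} → bound ≤ i → coeff i ≡ 0ℤ

open Polynomial

∑ℤ : ∀ {n} → Vector ℤ n → ℤ
∑ℤ = RawSemiringDefinitions.sum ℤ.+-*-rawSemiring

∑ℤ-zero : ∀ {n} (t : Vector ℤ n) → (∀ i → t i ≡ 0ℤ) → ∑ℤ t ≡ 0ℤ
∑ℤ-zero {zero}  t t≡0 = refl
∑ℤ-zero {suc n} t t≡0 = cong₂ ℤ._+_ (t≡0 zero) (∑ℤ-zero (t ∘ suc) (t≡0 ∘ suc))

monomial : ℤ → ℕ → Polynomial
monomial a d .coeff i = if i ≡ᵇ d then a else 0ℤ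
monomial a d .bound = suc d
monomial a d .vanish d<i = cong (if_then a else 0ℤ) (≡ᵇ-false d<i)
  where
  ≡ᵇ-false : ∀ {i d} → d < i → (i ≡ᵇ d) ≡ false
  ≡ᵇ-false {d = zero}  (ℕ.s≤s _)   = refl
  ≡ᵇ-false {d = suc d} (ℕ.s≤s d<i) = ≡ᵇ-false d<i

_+ₚ_ : Polynomial → Polynomial → Polynomial
(p +ₚ q) .coeff i = coeff p i ℤ.+ coeff q i
(p +ₚ q) .bound = bound p ℕ.⊔ bound q
(p +ₚ q) .vanish b≤i = cong₂ ℤ._+_
  (vanish p (ℕₚ.≤-trans (ℕₚ.m≤m⊔n _ _) b≤i))
  (vanish q (ℕₚ.≤-trans (ℕₚ.m≤n⊔m (bound p) _) b≤i))

-ₚ_ : Polynomial → Polynomial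
(-ₚ p) .coeff i = ℤ.- coeff p i
(-ₚ p) .bound = bound p
(-ₚ p) .vanish b≤i = cong ℤ.-_ (vanish p b≤i)

_*ₚ_ : Polynomial → Polynomial → Polynomial
(p *ₚ q) .coeff i = ∑ℤ {suc i} λ j → coeff p (toℕ j) ℤ.* coeff q (i ∸ toℕ j)
(p *ₚ q) .bound = bound p ℕ.+ bound q
(p *ₚ q) .vanish {i} b≤i = ∑ℤ-zero {suc i} _ term
  where
  term : ∀ j → coeff p (toℕ j) ℤ.* coeff q (i ∸ toℕ j) ≡ 0ℤ
  term j with bound p ℕₚ.≤? toℕ j
  ... | yes b≤j = trans (cong (ℤ._* _) (vanish p b≤j)) (ℤₚ.*-zeroˡ (coeff q (i ∸ toℕ j)))
  ... | no b≰j  = trans (cong (coeff p (toℕ j) ℤ.*_) (vanish q bq≤i∸j))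
                    (ℤₚ.*-zeroʳ (coeff p (toℕ j)))
    where
    bq≤i∸j : bound q ≤ i ∸ toℕ j
    bq≤i∸j = ℕₚ.≤-trans
      (subst (ℕ._≤ i ∸ bound p) (ℕₚ.m+n∸m≡n (bound p) (bound q)) (ℕₚ.∸-monoˡ-≤ (bound p) b≤i))
      (ℕₚ.∸-monoʳ-≤ i (ℕₚ.<⇒≤ (ℕₚ.≰⇒> b≰j)))

ℤ[x] : RawRing 0ℓ 0ℓ
ℤ[x] = record
  { Carrier = Polynomial
  ; _≈_     = λ p q → ∀ i → coeff p i ≡ coeff q i
  ; _+_     = _+ₚ_
  ; _*_     = _*ₚ_
  ; -_      = -ₚ_
  ; 0#      = monomial 0ℤ 0
  ; 1#      = monomial 1ℤ 0
  }

cubePolynomial : Graph → Polynomial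
cubePolynomial G .coeff m = + c m G
cubePolynomial G .bound = order G
cubePolynomial G .vanish N≤m = cong +_ (c-vanish G N≤m)

-- In a series f, f n k is the coefficient of yⁿzᵏ.
module _ {a ℓ} (R : RawRing a ℓ) where
  private module R = RawRing R
  open RawSemiringDefinitions R.rawSemiring using (sum)

  monomialSeries : R.Carrier → ℕ → ℕ → ℕ → ℕ → R.Carrier
  monomialSeries r i j n k =
    if (n ≡ᵇ i) ∧ (k ≡ᵇ j) then r else R.0#

  _⟦y,z⟧ : RawRing a ℓ
  _⟦y,z⟧ = record
    { Carrier = ℕ → ℕ → R.Carrier
    ; _≈_     = λ f g → ∀ n k → f n k R.≈ g n k
    ; _+_     = λ f g n k → f n k R.+ g n k
    ; _*_     = λ f g n k → sum {suc n} λ i → sum {suc k} λ j →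
                  f (toℕ i) (toℕ j) R.* g (n ∸ toℕ i) (k ∸ toℕ j)
    ; -_      = λ f n k → R.- f n k
    ; 0#      = λ _ _ → R.0#
    ; 1#      = monomialSeries R.1# 0 0
    }

open RawRing (ℤ[x] ⟦y,z⟧) public
  using (_≈_; _+_; _*_; -_; 1#) renaming (Carrier to Series; rawSemiring to seriesRawSemiring)
open RawSemiringDefinitions seriesRawSemiring public using (_^_)

infixl 6 _-_
_-_ : Series → Series → Series
f - g = f + (- g)

x y z : Series
x = monomialSeries ℤ[x] (monomial 1ℤ 1) 0 0
y = monomialSeries ℤ[x] (RawRing.1# ℤ[x]) 1 0
z = monomialSeries ℤ[x] (RawRing.1# ℤ[x]) 0 1

-- f = g / h, where the fraction denotes g times the multiplicative inverse
-- of h, so that invertibility of h is part of the assertion.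
infix 4 _≈_÷_
_≈_÷_ : Series → Series → Series → Set
f ≈ g ÷ h = Σ[ h⁻¹ ∈ Series ] (h * h⁻¹ ≈ 1#) × (f ≈ g * h⁻¹)

_IsSubwordOf_ : Rel (List Bit) 0ℓ
_IsSubwordOf_ = Infix _≡_

record Padovan (w : List Bit) : Set where
  field
    starts : List.head w ≡ just 0b
    ends   : List.last w ≡ just 0b
    no00   : ¬ ((0b ∷ 0b ∷ []) IsSubwordOf w)
    no111  : ¬ ((1b ∷ 1b ∷ 1b ∷ []) IsSubwordOf w)

padovan? : Decidable Padovan
padovan? w = map′
  (λ (p , q , r , s) → record { starts = p ; ends = q ; no00 = r ; no111 = s })
  (λ P → let open Padovan P in starts , ends , no00 , no111)
  (  Maybeₚ.≡-dec Finₚ._≟_ (List.head w) (just 0b)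
  ×-dec Maybeₚ.≡-dec Finₚ._≟_ (List.last w) (just 0b)
  ×-dec ¬? (infix? Finₚ._≟_ (0b ∷ 0b ∷ []) w)
  ×-dec ¬? (infix? Finₚ._≟_ (1b ∷ 1b ∷ 1b ∷ []) w))

ones : ∀ {n} → Vec Bit n → ℕ
ones = Vec.count (Finₚ._≟ 1b)

infix 4 _⟶_ _⟶?_

-- v arises from u by replacing one subword 01 with 10.
data _⟶_ : ∀ {n} → Rel (Vec Bit n) 0ℓ where
  here  : ∀ {n} {w : Vec Bit n} → 0b ∷ 1b ∷ w ⟶ 1b ∷ 0b ∷ w
  there : ∀ {n a} {u v : Vec Bit n} → u ⟶ v → a ∷ u ⟶ a ∷ v

⟶-irrefl : ∀ {n} {u : Vec Bit n} → ¬ u ⟶ u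
⟶-irrefl (there s) = ⟶-irrefl s

_⟶?_ : ∀ {n} → Decidable₂ (_⟶_ {n})
[] ⟶? [] = no λ ()
(zero ∷ u) ⟶? (zero ∷ v) = map′ there (λ { (there s) → s }) (u ⟶? v)
(suc zero ∷ u) ⟶? (suc zero ∷ v) = map′ there (λ { (there s) → s }) (u ⟶? v)
(suc zero ∷ u) ⟶? (zero ∷ v) = no λ ()
(zero ∷ []) ⟶? (suc zero ∷ []) = no λ ()
(zero ∷ zero ∷ u) ⟶? (suc zero ∷ b ∷ v) = no λ ()
(zero ∷ suc zero ∷ u) ⟶? (suc zero ∷ suc zero ∷ v) = no λ ()
(zero ∷ suc zero ∷ u) ⟶? (suc zero ∷ zero ∷ v) =
  map′ (λ { refl → here }) (λ { here → refl }) (≡-dec Finₚ._≟_ u v)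
  where open import Data.Vec.Properties using (≡-dec)

padovanGraph : ℕ → ℕ → Graph
padovanGraph n k = record
  { V        = [ w ∈ Vec Bit n ∣ Padovan (toList w) × ones w ≡ k ]
  ; _~_      = λ u v → value u ⟶ value v ⊎ value v ⟶ value u
  ; ~-irrefl = [ ⟶-irrefl , ⟶-irrefl ]′
  ; ~-sym    = Sum.swap
  ; _~?_     = λ u v → (value u ⟶? value v) ⊎-dec (value v ⟶? value u)
  ; finite   = finite-refinement (finite-vec 2 n)
                 (λ w → padovan? (toList w) ×-dec (ones w ℕₚ.≟ k))
  }

InRange : ℕ → ℕ → Set
InRange n k = 1 ≤ n × n / 2 ≤ k × k ≤ (2 ℕ.* n ∸ 2) / 3

inRange? : Decidable₂ InRange
inRange? n k = (1 ℕₚ.≤? n) ×-dec (n / 2 ℕₚ.≤? k) ×-dec (k ℕₚ.≤? (2 ℕ.* n ∸ 2) / 3)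

-- Outside the range the cube polynomial is 0, by c-vanish for the graph of
-- order 0 (its only induced subgraph, having no vertex, is not a Q m).
Φ : ℕ → ℕ → Graph
Φ n k = if does (inRange? n k) then padovanGraph n k else emptyGraph

cubeSeries : Series
cubeSeries n k = cubePolynomial (Φ n k)

{-# OPTIONS --safe #-}

-- A Padovan word is a sequence of blocks 01 and 011 followed by a final 0, and
-- an edge exchanges two adjacent distinct blocks, 01 011 ↔ 011 01. In an
-- induced m-cube of words the third letter changes along at most one edge at
-- each vertex (that edge swaps letters 3 and 4), and a Boolean function on a
-- cube with this property is constant or a coordinate. So all words of the
-- cube begin with 01, or all with 011, or one direction of the cube swaps the
-- first two blocks; removing this tile and iterating, the cubes of dimension m
-- correspond to the tilings with m tiles {01011, 01101}. The tiles have weights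
-- y²z, y³z² and xy⁵z³, which gives the generating function.

module Submission where

open import Defs
import Algebra.Definitions.RawSemiring as RawSemiringDefinitions
open import Algebra.Bundles.Raw using (RawRing)
import Algebra.Properties.CommutativeMonoid.Sum as Sums
open import Data.Bool.Base using (T; if_then_else_)
open import Data.Digit using (Bit; 0b; 1b)
open import Data.Empty using (⊥-elim)
open import Data.Fin.Base using (Fin; zero; suc; toℕ; opposite)
open import Data.Fin.Permutation using (↔⇒≡)
import Data.Fin.Properties as Finₚ
open import Data.Fin.Subset using (Subset; _∈_)
open import Data.Fin.Subset.Properties using (_∈?_; ⊆-antisym)
open import Data.Integer.Base as ℤ using (ℤ; 0ℤ; 1ℤ; +_)
import Data.Integer.Properties as ℤₚ
open import Data.Irrelevant using ([_])
open import Data.List.Base as List using ([]; _∷_)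
open import Data.List.Relation.Binary.Infix.Heterogeneous using (here; there)
open import Data.List.Relation.Binary.Prefix.Heterogeneous using ([]; _∷_)
open import Data.Maybe.Base using (just)
open import Data.Nat.Base as ℕ using (ℕ; zero; suc; _∸_)
open import Data.Nat.DivMod using (m*n/n≡m; m<n*o⇒m/o<n; /-monoˡ-≤)
import Data.Nat.Properties as ℕₚ
open import Data.Product.Base using (Σ-syntax; ∃; _×_; _,_; proj₁; proj₂)
open import Data.Refinement using (Refinement-syntax; _,_; value)
open import Data.Sum.Base as Sum using (_⊎_; inj₁; inj₂)
open import Data.Sum.Function.Propositional using (_⊎-↔_)
open import Data.Vec.Base as Vec using (Vec; []; _∷_; _++_; toList; replicate)
open import Data.Vec.Properties
  using (∷-injectiveˡ; ∷-injectiveʳ; lookup∘tabulate; []=⇒lookup; lookup⇒[]=)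
open import Function.Base using (_∘_; id)
open import Function.Bundles using (_↔_; Inverse; mk↔ₛ′; Equivalence; mk⇔)
open import Function.Construct.Composition using (_↔-∘_)
open import Function.Construct.Symmetry using (↔-sym)
open import Relation.Binary.PropositionalEquality
  using (_≡_; _≢_; refl; sym; trans; cong; cong₂; subst; subst₂)
open import Relation.Nullary using (¬_; Dec; yes; no; does; contradiction)
open import Relation.Nullary.Decidable
  using (map′; _×-dec_; isYes≗does; toWitness; dec-true; decidable-stable; recompute)
open import Relation.Unary using (Decidable)

open Polynomial using (coeff)
open Sums ℤₚ.+-0-commutativeMonoid using (sum-cong-≗; ∑-distrib-+)
open RawSemiringDefinitions (RawRing.rawSemiring ℤ[x]) using () renaming (sum to sumₚ)

-- Padovan words and tilings

-- Every constructor starts with `0b`, so the remainder `w` supplies the 0 that closes the run of 1s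
-- before it.
data Blocks : ∀ {n} → Vec Bit n → Set where
  end    : Blocks (0b ∷ [])
  single : ∀ {n} {w : Vec Bit n} → Blocks w → Blocks (0b ∷ 1b ∷ w)
  double : ∀ {n} {w : Vec Bit n} → Blocks w → Blocks (0b ∷ 1b ∷ 1b ∷ w)

-- After a 0 the absence of 00 forces a 1, and the absence of 111 leaves a run of one or two 1s. The
-- recursion resumes at the 0 after that run, so the tail again starts with 0.
Padovan⇒Blocks : ∀ {n} (w : Vec Bit n) → Padovan (toList w) → Blocks w
Padovan⇒Blocks [] p = contradiction (Padovan.starts p) λ ()
Padovan⇒Blocks (suc zero ∷ w) p = contradiction (Padovan.starts p) λ ()
Padovan⇒Blocks (zero ∷ []) p = end
Padovan⇒Blocks (zero ∷ zero ∷ w) p = contradiction (here (refl ∷ refl ∷ [])) (Padovan.no00 p)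
Padovan⇒Blocks (zero ∷ suc zero ∷ []) p = contradiction (Padovan.ends p) λ ()
Padovan⇒Blocks (zero ∷ suc zero ∷ zero ∷ w) p = single (Padovan⇒Blocks (zero ∷ w) record
  { starts = refl
  ; ends   = Padovan.ends p
  ; no00   = λ q → Padovan.no00 p (there (there q))
  ; no111  = λ q → Padovan.no111 p (there (there q))
  })
Padovan⇒Blocks (zero ∷ suc zero ∷ suc zero ∷ []) p = contradiction (Padovan.ends p) λ ()
Padovan⇒Blocks (zero ∷ suc zero ∷ suc zero ∷ suc zero ∷ w) p =
  contradiction (there (here (refl ∷ refl ∷ refl ∷ []))) (Padovan.no111 p)
Padovan⇒Blocks (zero ∷ suc zero ∷ suc zero ∷ zero ∷ w) p = double (Padovan⇒Blocks (zero ∷ w) record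
  { starts = refl
  ; ends   = Padovan.ends p
  ; no00   = λ q → Padovan.no00 p (there (there (there q)))
  ; no111  = λ q → Padovan.no111 p (there (there (there q)))
  })

Blocks⇒Padovan : ∀ {n} {w : Vec Bit n} → Blocks w → Padovan (toList w)
Blocks⇒Padovan p = record { starts = starts p ; ends = ends p ; no00 = no00 p ; no111 = no111 p }
  where
  starts : ∀ {n} {w : Vec Bit n} → Blocks w → List.head (toList w) ≡ just 0b
  starts end        = refl
  starts (single _) = refl
  starts (double _) = refl

  ends : ∀ {n} {w : Vec Bit n} → Blocks w → List.last (toList w) ≡ just 0b
  ends end                   = refl
  ends (single end)          = refl
  ends (single p@(single _)) = ends p
  ends (single p@(double _)) = ends p
  ends (double end)          = refl
  ends (double p@(single _)) = ends p
  ends (double p@(double _)) = ends p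

  no00 : ∀ {n} {w : Vec Bit n} → Blocks w → ¬ ((0b ∷ 0b ∷ []) IsSubwordOf toList w)
  no00 end        (here (_ ∷ ()))
  no00 end        (there (here ()))
  no00 (single p) (here (_ ∷ () ∷ _))
  no00 (single p) (there (here (() ∷ _)))
  no00 (single p) (there (there q)) = no00 p q
  no00 (double p) (here (_ ∷ () ∷ _))
  no00 (double p) (there (here (() ∷ _)))
  no00 (double p) (there (there (here (() ∷ _))))
  no00 (double p) (there (there (there q))) = no00 p q

  no111 : ∀ {n} {w : Vec Bit n} → Blocks w → ¬ ((1b ∷ 1b ∷ 1b ∷ []) IsSubwordOf toList w)
  no111 end                 (here (() ∷ _))
  no111 end                 (there (here ()))
  no111 (single p)          (here (() ∷ _))
  -- Splitting the inner `Blocks` exposes the 0 that ends the run of 1s.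
  no111 (single end)        (there (here (_ ∷ () ∷ _)))
  no111 (single (single p)) (there (here (_ ∷ () ∷ _)))
  no111 (single (double p)) (there (here (_ ∷ () ∷ _)))
  no111 (single p)          (there (there q)) = no111 p q
  no111 (double p)          (here (() ∷ _))
  no111 (double end)        (there (here (_ ∷ _ ∷ () ∷ _)))
  no111 (double (single p)) (there (here (_ ∷ _ ∷ () ∷ _)))
  no111 (double (double p)) (there (here (_ ∷ _ ∷ () ∷ _)))
  no111 (double end)        (there (there (here (_ ∷ () ∷ _))))
  no111 (double (single p)) (there (there (here (_ ∷ () ∷ _))))
  no111 (double (double p)) (there (there (here (_ ∷ () ∷ _))))
  no111 (double p)          (there (there (there q))) = no111 p q

-- Edges between words, and the cubes described by tilings

infix 4 _∼_

-- The adjacency of `padovanGraph` on bare words, free of the proofs carried by its vertices.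
_∼_ : ∀ {n} → Vec Bit n → Vec Bit n → Set
u ∼ v = u ⟶ v ⊎ v ⟶ u

⟶-cancel-∷ : ∀ {n a} {u v : Vec Bit n} → a ∷ u ⟶ a ∷ v → u ⟶ v
⟶-cancel-∷ (there s) = s

∼-cancel-++ : ∀ {k n} (p : Vec Bit k) {u v : Vec Bit n} → p ++ u ∼ p ++ v → u ∼ v
∼-cancel-++ []      e = e
∼-cancel-++ (_ ∷ p) e = ∼-cancel-++ p (Sum.map ⟶-cancel-∷ ⟶-cancel-∷ e)

∼-++ : ∀ {k n} (p : Vec Bit k) {u v : Vec Bit n} → u ∼ v → p ++ u ∼ p ++ v
∼-++ []      e = e
∼-++ (_ ∷ p) e = Sum.map there there (∼-++ p e)

-- Only `here` changes the first letter, so the exchange happens at the front.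
swap-rest : ∀ {n} {u v : Vec Bit n} → 0b ∷ 1b ∷ u ∼ 1b ∷ 0b ∷ v → u ≡ v
swap-rest (inj₁ here) = refl
swap-rest (inj₂ ())

-- A tile carries its first 0 but not the 0 that follows it: the final letter
-- of the word is left over, so a Tiling n k m describes words of length suc n.
data Tiling : ℕ → ℕ → ℕ → Set where
  end   : Tiling 0 0 0
  short : ∀ {n k m} → Tiling n k m → Tiling (2 ℕ.+ n) (1 ℕ.+ k) m
  long  : ∀ {n k m} → Tiling n k m → Tiling (3 ℕ.+ n) (2 ℕ.+ k) m
  swap  : ∀ {n k m} → Tiling n k m → Tiling (5 ℕ.+ n) (3 ℕ.+ k) (1 ℕ.+ m)

-- A cube coordinate orders the two blocks of one swap tile. The convention makes the bit equal to
-- the third letter written by the tile, which is how `classify` recovers it.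
resolve : ∀ {n k m} → Tiling n k m → Vec Bit m → Vec Bit (suc n)
resolve end       []             = 0b ∷ []
resolve (short t) v              = 0b ∷ 1b ∷ resolve t v
resolve (long t)  v              = 0b ∷ 1b ∷ 1b ∷ resolve t v
resolve (swap t)  (zero ∷ v)     = 0b ∷ 1b ∷ 0b ∷ 1b ∷ 1b ∷ resolve t v
resolve (swap t)  (suc zero ∷ v) = 0b ∷ 1b ∷ 1b ∷ 0b ∷ 1b ∷ resolve t v

resolve-blocks : ∀ {n k m} (t : Tiling n k m) v → Blocks (resolve t v)
resolve-blocks end       []             = end
resolve-blocks (short t) v              = single (resolve-blocks t v)
resolve-blocks (long t)  v              = double (resolve-blocks t v)
resolve-blocks (swap t)  (zero ∷ v)     = single (double (resolve-blocks t v))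
resolve-blocks (swap t)  (suc zero ∷ v) = double (single (resolve-blocks t v))

resolve-ones : ∀ {n k m} (t : Tiling n k m) v → ones (resolve t v) ≡ k
resolve-ones end       []             = refl
resolve-ones (short t) v              = cong (1 ℕ.+_) (resolve-ones t v)
resolve-ones (long t)  v              = cong (2 ℕ.+_) (resolve-ones t v)
resolve-ones (swap t)  (zero ∷ v)     = cong (3 ℕ.+_) (resolve-ones t v)
resolve-ones (swap t)  (suc zero ∷ v) = cong (3 ℕ.+_) (resolve-ones t v)

++-cancel : ∀ {A : Set} {k n} (p : Vec A k) {u v : Vec A n} → p ++ u ≡ p ++ v → u ≡ v
++-cancel []      e = e
++-cancel (_ ∷ p) e = ++-cancel p (∷-injectiveʳ e)

resolve-injective : ∀ {n k m} (t : Tiling n k m) {u v} → resolve t u ≡ resolve t v → u ≡ v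
resolve-injective end {[]} {[]} _ = refl
resolve-injective (short t) e = resolve-injective t (++-cancel (0b ∷ 1b ∷ []) e)
resolve-injective (long t)  e = resolve-injective t (++-cancel (0b ∷ 1b ∷ 1b ∷ []) e)
resolve-injective (swap t) {zero ∷ _} {zero ∷ _} e =
  cong (0b ∷_) (resolve-injective t (++-cancel (0b ∷ 1b ∷ 0b ∷ 1b ∷ 1b ∷ []) e))
resolve-injective (swap t) {suc zero ∷ _} {suc zero ∷ _} e =
  cong (1b ∷_) (resolve-injective t (++-cancel (0b ∷ 1b ∷ 1b ∷ 0b ∷ 1b ∷ []) e))
resolve-injective (swap t) {zero ∷ _} {suc zero ∷ _} ()
resolve-injective (swap t) {suc zero ∷ _} {zero ∷ _} ()

resolve-preserves : ∀ {n k m} (t : Tiling n k m) {u v} → DifferOnce u v → resolve t u ∼ resolve t v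
resolve-preserves (short t) d = ∼-++ (0b ∷ 1b ∷ []) (resolve-preserves t d)
resolve-preserves (long t)  d = ∼-++ (0b ∷ 1b ∷ 1b ∷ []) (resolve-preserves t d)
resolve-preserves (swap t) {zero ∷ _} (there d) =
  ∼-++ (0b ∷ 1b ∷ 0b ∷ 1b ∷ 1b ∷ []) (resolve-preserves t d)
resolve-preserves (swap t) {suc zero ∷ _} (there d) =
  ∼-++ (0b ∷ 1b ∷ 1b ∷ 0b ∷ 1b ∷ []) (resolve-preserves t d)
resolve-preserves (swap t) {zero ∷ _}     {zero ∷ _}     (here a≢b) = contradiction refl a≢b
resolve-preserves (swap t) {zero ∷ _}     {suc zero ∷ _} (here _)   = inj₁ (there (there here))
resolve-preserves (swap t) {suc zero ∷ _} {zero ∷ _}     (here _)   = inj₂ (there (there here))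
resolve-preserves (swap t) {suc zero ∷ _} {suc zero ∷ _} (here a≢b) = contradiction refl a≢b

resolve-reflects : ∀ {n k m} (t : Tiling n k m) {u v} → resolve t u ∼ resolve t v → DifferOnce u v
resolve-reflects end {[]} {[]} (inj₁ (there ()))
resolve-reflects end {[]} {[]} (inj₂ (there ()))
resolve-reflects (short t) e = resolve-reflects t (∼-cancel-++ (0b ∷ 1b ∷ []) e)
resolve-reflects (long t)  e = resolve-reflects t (∼-cancel-++ (0b ∷ 1b ∷ 1b ∷ []) e)
resolve-reflects (swap t) {zero ∷ _} {zero ∷ _} e =
  there (resolve-reflects t (∼-cancel-++ (0b ∷ 1b ∷ 0b ∷ 1b ∷ 1b ∷ []) e))
resolve-reflects (swap t) {suc zero ∷ _} {suc zero ∷ _} e =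
  there (resolve-reflects t (∼-cancel-++ (0b ∷ 1b ∷ 1b ∷ 0b ∷ 1b ∷ []) e))
-- The words first differ at letter three, so the edge exchanges letters three and four. The
-- remainders therefore coincide, and by injectivity so do the remaining bits.
resolve-reflects (swap t) {zero ∷ u} {suc zero ∷ v} e
  with refl ← resolve-injective t {u} {v} (∷-injectiveʳ (swap-rest (∼-cancel-++ (0b ∷ 1b ∷ []) e)))
  = here λ ()
resolve-reflects (swap t) {suc zero ∷ u} {zero ∷ v} e
  with refl ← resolve-injective t {v} {u}
                (∷-injectiveʳ (swap-rest (Sum.swap (∼-cancel-++ (0b ∷ 1b ∷ []) e))))
  = here λ ()

-- One cube has many parametrisations, differing by automorphisms, so cubes are compared through
-- their vertex sets.
SameImage : {A B C : Set} → (A → C) → (B → C) → Set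
SameImage f g = (∀ u → ∃ λ v → f u ≡ g v) × (∀ v → ∃ λ u → g v ≡ f u)

-- Reading the first tile off the third letter

third : ∀ {n} → Vec Bit (3 ℕ.+ n) → Bit
third (_ ∷ _ ∷ a ∷ _) = a

resolve-head : ∀ {n k m} (t : Tiling n k m) v → Vec.head (resolve t v) ≡ 0b
resolve-head end       []             = refl
resolve-head (short t) v              = refl
resolve-head (long t)  v              = refl
resolve-head (swap t)  (zero ∷ v)     = refl
resolve-head (swap t)  (suc zero ∷ v) = refl

third-short : ∀ {n k m} (t : Tiling n k m) v → third (resolve (short t) v) ≡ 0b
third-short t v with resolve t v | resolve-head t v
... | _ ∷ _ | refl = refl

SameImage-++ : ∀ {k n m} (p : Vec Bit k) {f g : Vec Bit m → Vec Bit n} →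
               SameImage ((p ++_) ∘ f) ((p ++_) ∘ g) → SameImage f g
SameImage-++ p (f⊆g , g⊆f) =
    (λ u → let v , e = f⊆g u in v , ++-cancel p e)
  , (λ v → let u , e = g⊆f v in u , ++-cancel p e)

differ : ∀ {n} {u v : Vec Bit (3 ℕ.+ n)} → third u ≡ 0b → third v ≡ 1b → u ≢ v
differ {u = _ ∷ _ ∷ _ ∷ _} refl () refl

zeros : ∀ {m} → Vec Bit m
zeros = replicate _ 0b

-- A word whose swap bit is 0 has third letter 0, so it can only match a word of `swap t′` with bit
-- 0; thus the faces with bit 0 are matched.
resolve-tail : ∀ {n k k′ m} (t : Tiling n k m) (t′ : Tiling n k′ m) →
               (∀ u → ∃ λ v → resolve (swap t) u ≡ resolve (swap t′) v) →
               ∀ u → ∃ λ v → resolve t u ≡ resolve t′ v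
resolve-tail t t′ t⊆t′ u with t⊆t′ (0b ∷ u)
... | zero ∷ v , e = v , ++-cancel (0b ∷ 1b ∷ 0b ∷ 1b ∷ 1b ∷ []) e
... | suc zero ∷ v , ()

-- Over the image, the third letter is always 0 for a first tile `short`, always 1 for `long`, and
-- takes both values for `swap`. Each mixed case exhibits a word violating this.
image-determines : ∀ {n k m} (t t′ : Tiling n k m) → SameImage (resolve t) (resolve t′) → t ≡ t′
image-determines end end _ = refl
image-determines (short t) (short t′) s = cong short (image-determines t t′ (SameImage-++ (0b ∷ 1b ∷ []) s))
image-determines (long t) (long t′) s = cong long (image-determines t t′ (SameImage-++ (0b ∷ 1b ∷ 1b ∷ []) s))
image-determines (swap t) (swap t′) (t⊆t′ , t′⊆t) =
  cong swap (image-determines t t′ (resolve-tail t t′ t⊆t′ , resolve-tail t′ t t′⊆t))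
image-determines (short t) (long t′) (t⊆t′ , _) =
  ⊥-elim (differ (third-short t zeros) refl (proj₂ (t⊆t′ zeros)))
image-determines (long t) (short t′) (_ , t′⊆t) =
  ⊥-elim (differ (third-short t′ zeros) refl (proj₂ (t′⊆t zeros)))
image-determines (short t) (swap t′) (_ , t′⊆t) =
  ⊥-elim (differ (third-short t _) refl (sym (proj₂ (t′⊆t (1b ∷ zeros)))))
image-determines (swap t) (short t′) (t⊆t′ , _) =
  ⊥-elim (differ (third-short t′ _) refl (sym (proj₂ (t⊆t′ (1b ∷ zeros)))))
image-determines (long t) (swap t′) (_ , t′⊆t) =
  ⊥-elim (differ refl refl (proj₂ (t′⊆t (0b ∷ zeros))))
image-determines (swap t) (long t′) (t⊆t′ , _) =
  ⊥-elim (differ refl refl (proj₂ (t⊆t′ (0b ∷ zeros))))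

-- Classification of the cubes of words

-- Adjust the tail with the head fixed, then flip the head if necessary.
cube-connected : ∀ {m} (P : Vec Bit m → Set) → (∀ {u v} → DifferOnce u v → P u → P v) →
                 ∀ {u v} → P u → P v
cube-connected P step {[]} {[]} p = p
cube-connected P step {a ∷ u} {b ∷ v} p with cube-connected (P ∘ (a ∷_)) (step ∘ there) {u} {v} p
... | q with a Finₚ.≟ b
...   | yes refl = q
...   | no a≢b   = step (here a≢b) q

-- In the case `along`, `f` is a coordinate or its complement. The map `insert` hides which:
-- `insert b` parametrises the face where `f` is `b`, and its two faces are joined by parallel
-- edges.
data Direction : ∀ {m} → (Vec Bit m → Bit) → Set where
  constant : ∀ {m} {f : Vec Bit m → Bit} a → (∀ u → f u ≡ a) → Direction f
  along    : ∀ {m} {f : Vec Bit (suc m) → Bit} (insert : Bit → Vec Bit m → Vec Bit (suc m)) →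
             (∀ b w → f (insert b w) ≡ b) →
             (∀ u → ∃ λ w → u ≡ insert (f u) w) →
             (∀ {b u v} → insert b u ≡ insert b v → u ≡ v) →
             (∀ {b u v} → DifferOnce u v → DifferOnce (insert b u) (insert b v)) →
             (∀ {w} → DifferOnce (insert 0b w) (insert 1b w)) →
             Direction f

-- The involution `π` treats the head coordinate and its complement together.
along-head : ∀ {m} {f : Vec Bit (suc m) → Bit} (π : Bit → Bit) → (∀ b → π (π b) ≡ b) →
             (∀ b w → f (b ∷ w) ≡ π b) → Direction f
along-head π inv f≡π = along (λ b w → π b ∷ w)
  (λ b w → trans (f≡π (π b) w) (inv b))
  (λ { (a ∷ w) → w , cong (_∷ w) (sym (trans (cong π (f≡π a w)) (inv a))) })
  ∷-injectiveʳ
  there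
  (here λ e → contradiction (trans (sym (inv 0b)) (trans (cong π e) (inv 1b))) λ ())

along-tail : ∀ {m} {f : Vec Bit (suc m) → Bit} → (∀ a w → f (a ∷ w) ≡ f (0b ∷ w)) →
             Direction (f ∘ (0b ∷_)) → Direction f
along-tail f≡f₀ (constant a f₀≡a) = constant a λ { (b ∷ w) → trans (f≡f₀ b w) (f₀≡a w) }
along-tail {f = f} f≡f₀ (along insert value cover inj preserve direction) = along
  (λ { b (a ∷ w) → a ∷ insert b w })
  (λ { b (a ∷ w) → trans (f≡f₀ a (insert b w)) (value b w) })
  (λ { (a ∷ u) → let w , e = cover u in
         a ∷ w , cong (a ∷_) (trans e (cong (λ b → insert b w) (sym (f≡f₀ a u)))) })
  (λ { {u = a ∷ u} {b ∷ v} e → cong₂ _∷_ (∷-injectiveˡ e) (inj (∷-injectiveʳ e)) })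
  (λ { (here a≢b) → here a≢b ; (there d) → there (preserve d) })
  (λ { {a ∷ w} → there direction })

-- Sensitivity at most 1, in the sense of Boolean function complexity.
AtMostOneSensitive : ∀ {m} → (Vec Bit m → Bit) → Set
AtMostOneSensitive f = ∀ {u v v′} → DifferOnce u v → DifferOnce u v′ → f u ≢ f v → f u ≢ f v′ → v ≡ v′

-- If `f` changes along the head edge over `w`, it changes along no other edge at either endpoint.
-- The same change then occurs over every neighbour of `w`, hence over the whole cube, and `f`
-- depends on the head alone. Otherwise `f` ignores the head, and induction applies to a facet.
direction : ∀ {m} (f : Vec Bit m → Bit) → AtMostOneSensitive f → Direction f
direction {zero}  f sens = constant (f []) λ { [] → refl }
direction {suc m} f sens = byHead
  where
  Agree : Vec Bit m → Set
  Agree w = f (0b ∷ w) ≡ f (1b ∷ w)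

  step : ∀ {a b w w′} → a ≢ b → f (a ∷ w) ≢ f (b ∷ w) → DifferOnce w w′ → f (a ∷ w) ≡ f (a ∷ w′)
  -- A second sensitive edge would have the same endpoint as the head edge, but their heads `a` and
  -- `b` differ.
  step a≢b f≢ d = decidable-stable (_ Finₚ.≟ _) λ f≢′ →
    a≢b (∷-injectiveˡ (sens (there d) (here a≢b) f≢′ f≢))

  step₀ : ∀ {w w′} → DifferOnce w w′ → ¬ Agree w → f (0b ∷ w) ≡ f (0b ∷ w′)
  step₀ d ¬e = step (λ ()) ¬e d

  step₁ : ∀ {w w′} → DifferOnce w w′ → ¬ Agree w → f (1b ∷ w) ≡ f (1b ∷ w′)
  step₁ d ¬e = step (λ ()) (¬e ∘ sym) d

  disagree-everywhere : ∀ {u v} → ¬ Agree u → ¬ Agree v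
  disagree-everywhere = cube-connected (¬_ ∘ Agree) λ d ¬e →
    subst₂ _≢_ (step₀ d ¬e) (step₁ d ¬e) ¬e

  values : ¬ Agree zeros → ∀ w → f (0b ∷ w) ≡ f (0b ∷ zeros) × f (1b ∷ w) ≡ f (1b ∷ zeros)
  values ¬e w = cube-connected (λ w → f (0b ∷ w) ≡ f (0b ∷ zeros) × f (1b ∷ w) ≡ f (1b ∷ zeros))
    (λ { d (p , q) → trans (sym (step₀ d (disagree-everywhere ¬e))) p
                   , trans (sym (step₁ d (disagree-everywhere ¬e))) q })
    {zeros} {w} (refl , refl)

  byHead : Direction f
  -- Testing over `zeros` suffices, since a disagreement over any tail spreads to `zeros`.
  byHead with f (0b ∷ zeros) in e₀ | f (1b ∷ zeros) in e₁
  ... | zero | zero = along-tail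
    (λ { zero w → refl
       ; (suc zero) w → sym (decidable-stable (_ Finₚ.≟ _) λ ¬e →
           disagree-everywhere ¬e (trans e₀ (sym e₁))) })
    (direction (f ∘ (0b ∷_)) λ d d′ p q → ∷-injectiveʳ (sens (there d) (there d′) p q))
  ... | suc zero | suc zero = along-tail
    (λ { zero w → refl
       ; (suc zero) w → sym (decidable-stable (_ Finₚ.≟ _) λ ¬e →
           disagree-everywhere ¬e (trans e₀ (sym e₁))) })
    (direction (f ∘ (0b ∷_)) λ d d′ p q → ∷-injectiveʳ (sens (there d) (there d′) p q))
  ... | zero | suc zero = along-head id (λ _ → refl)
    λ { zero w → trans (proj₁ (values ¬e w)) e₀ ; (suc zero) w → trans (proj₂ (values ¬e w)) e₁ }
    where
    ¬e : ¬ Agree zeros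
    ¬e e = contradiction (trans (sym e₀) (trans e e₁)) λ ()
  -- On `Bit`, `opposite` is complementation.
  ... | suc zero | zero = along-head opposite Finₚ.opposite-involutive
    λ { zero w → trans (proj₁ (values ¬e w)) e₀ ; (suc zero) w → trans (proj₂ (values ¬e w)) e₁ }
    where
    ¬e : ¬ Agree zeros
    ¬e e = contradiction (trans (sym e₀) (trans e e₁)) λ ()

-- Edges that change the third letter

data SwapAtThird : ∀ {n} → Vec Bit n → Vec Bit n → Set where
  swapped : ∀ {n} {w : Vec Bit n} → Blocks w →
            SwapAtThird (0b ∷ 1b ∷ 0b ∷ 1b ∷ 1b ∷ w) (0b ∷ 1b ∷ 1b ∷ 0b ∷ 1b ∷ w)

-- Both words begin with 01, so the edge exchanges letters three and four. The 0 now at letter four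
-- of `v` is not its last letter, since `u` would then end in 1. So a 1 follows it, and the second
-- block of `u` is 011.
swapAtThird : ∀ {n} {u v : Vec Bit (3 ℕ.+ n)} → Blocks u → Blocks v → u ∼ v →
              third u ≡ 0b → third v ≡ 1b → SwapAtThird u v
swapAtThird {u = _ ∷ _ ∷ zero ∷ _} {_ ∷ _ ∷ suc zero ∷ _} (single p) (double q) e refl refl = go p q e
  where
  go : ∀ {n} {u v : Vec Bit n} → Blocks (0b ∷ u) → Blocks v →
       0b ∷ 1b ∷ 0b ∷ u ∼ 0b ∷ 1b ∷ 1b ∷ v → SwapAtThird (0b ∷ 1b ∷ 0b ∷ u) (0b ∷ 1b ∷ 1b ∷ v)
  go (single ()) (single _) (inj₁ (there (there here)))
  go (single ()) (double _) (inj₁ (there (there here)))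
  go (double p)  (single _) (inj₁ (there (there here))) = swapped p
  go (double ()) (double _) (inj₁ (there (there here)))
  go _ _ (inj₂ (there (there ())))

third-0 : ∀ {n} {w : Vec Bit (3 ℕ.+ n)} → Blocks w → third w ≡ 0b →
          ∃ λ v → w ≡ 0b ∷ 1b ∷ v × Blocks v
third-0 {w = _ ∷ _ ∷ _ ∷ _} (single p) _ = _ , refl , p
third-0 {w = _ ∷ _ ∷ _ ∷ _} (double p) ()

third-1 : ∀ {n} {w : Vec Bit (3 ℕ.+ n)} → Blocks w → third w ≡ 1b →
          ∃ λ v → w ≡ 0b ∷ 1b ∷ 1b ∷ v × Blocks v
third-1 (single end) ()
third-1 (single (single p)) ()
third-1 (single (double p)) ()
third-1 {w = _ ∷ _ ∷ _ ∷ _} (double p) _ = _ , refl , p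

-- Either end of a `SwapAtThird` determines the other. Two sensitive edges at a vertex thus lead to
-- the same word, and injectivity of `φ` identifies their endpoints.
third-sensitivity : ∀ {m n} (φ : Vec Bit m → Vec Bit (3 ℕ.+ n)) → (∀ u → Blocks (φ u)) →
                    (∀ {u v} → φ u ≡ φ v → u ≡ v) →
                    (∀ {u v} → DifferOnce u v → φ u ∼ φ v) →
                    AtMostOneSensitive (third ∘ φ)
third-sensitivity φ blocks injective preserves {u} {v} {v′} d d′ ≢v ≢v′ =
  injective (target (blocks u) (blocks v) (blocks v′) (preserves d) (preserves d′) ≢v ≢v′)
  where
  unique₁ : ∀ {n} {w w₁ w₂ : Vec Bit n} → SwapAtThird w w₁ → SwapAtThird w w₂ → w₁ ≡ w₂
  unique₁ (swapped _) (swapped _) = refl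

  unique₀ : ∀ {n} {w w₁ w₂ : Vec Bit n} → SwapAtThird w₁ w → SwapAtThird w₂ w → w₁ ≡ w₂
  unique₀ (swapped _) (swapped _) = refl

  target : ∀ {n} {w w₁ w₂ : Vec Bit (3 ℕ.+ n)} → Blocks w → Blocks w₁ → Blocks w₂ →
           w ∼ w₁ → w ∼ w₂ → third w ≢ third w₁ → third w ≢ third w₂ → w₁ ≡ w₂
  target {w = w} {w₁} {w₂} p p₁ p₂ e₁ e₂ ≢₁ ≢₂
    with third w in t | third w₁ in t₁ | third w₂ in t₂
  ... | zero     | zero     | _        = contradiction refl ≢₁
  ... | zero     | suc zero | zero     = contradiction refl ≢₂
  ... | zero     | suc zero | suc zero = unique₁ (swapAtThird p p₁ e₁ t t₁) (swapAtThird p p₂ e₂ t t₂)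
  ... | suc zero | suc zero | _        = contradiction refl ≢₁
  ... | suc zero | zero     | suc zero = contradiction refl ≢₂
  ... | suc zero | zero     | zero     =
    unique₀ (swapAtThird p₁ p (Sum.swap e₁) t₁ t) (swapAtThird p₂ p (Sum.swap e₂) t₂ t)

-- Embeddings of a cube as a subgraph; that their images are induced cubes follows from `classify`
-- and `resolve-reflects`.
WordCube : ∀ {m n} → (Vec Bit m → Vec Bit n) → Set
WordCube φ = (∀ u → Blocks (φ u)) × (∀ {u v} → φ u ≡ φ v → u ≡ v) ×
             (∀ {u v} → DifferOnce u v → φ u ∼ φ v)

WordCube-cancel-++ : ∀ {k m n} (p : Vec Bit k) {φ : Vec Bit m → Vec Bit (k ℕ.+ n)}
                     (ψ : Vec Bit m → Vec Bit n) → (∀ u → φ u ≡ p ++ ψ u) → (∀ u → Blocks (ψ u)) →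
                     WordCube φ → WordCube ψ
WordCube-cancel-++ p ψ φ≡ blocks (_ , injective , preserves) =
    blocks
  , (λ {u} {v} e → injective (trans (φ≡ u) (trans (cong (p ++_) e) (sym (φ≡ v)))))
  , (λ {u} {v} d → ∼-cancel-++ p (subst₂ _∼_ (φ≡ u) (φ≡ v) (preserves d)))

SameImage-resp-++ : ∀ {k m m′ n} (p : Vec Bit k) {φ : Vec Bit m → Vec Bit (k ℕ.+ n)}
                    {ψ : Vec Bit m → Vec Bit n} {χ : Vec Bit m′ → Vec Bit n} →
                    (∀ u → φ u ≡ p ++ ψ u) → SameImage ψ χ → SameImage φ ((p ++_) ∘ χ)
SameImage-resp-++ p φ≡ (ψ⊆χ , χ⊆ψ) =
    (λ u → let v , e = ψ⊆χ u in v , trans (φ≡ u) (cong (p ++_) e))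
  , (λ v → let u , e = χ⊆ψ v in u , trans (cong (p ++_) e) (sym (φ≡ u)))

swapped-split : ∀ {n} {u v : Vec Bit (5 ℕ.+ n)} → SwapAtThird u v →
                ∃ λ w → u ≡ 0b ∷ 1b ∷ 0b ∷ 1b ∷ 1b ∷ w × v ≡ 0b ∷ 1b ∷ 1b ∷ 0b ∷ 1b ∷ w × Blocks w
swapped-split (swapped p) = _ , refl , refl , p

-- Recursion on the length: by `direction`, the third letter is constantly 0, constantly 1 or a
-- coordinate, which gives `short`, `long` or `swap` as the first tile. The count `k` is existential
-- because `WordCube` does not mention it.
classify : ∀ n {m} (φ : Vec Bit m → Vec Bit (suc n)) → WordCube φ →
           ∃ λ k → Σ[ t ∈ Tiling n k m ] SameImage φ (resolve t)
classify zero {zero} φ (blocks , _) = 0 , end , (λ { [] → [] , φ≡ (blocks []) }) , (λ { [] → [] , sym (φ≡ (blocks [])) })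
  where
  φ≡ : ∀ {w : Vec Bit 1} → Blocks w → w ≡ 0b ∷ []
  φ≡ end = refl
classify zero {suc m} φ (blocks , injective , _) =
  contradiction (injective {0b ∷ zeros} {1b ∷ zeros} (unique (blocks _) (blocks _))) λ ()
  where
  unique : ∀ {u v : Vec Bit 1} → Blocks u → Blocks v → u ≡ v
  unique end end = refl
classify (suc zero) φ (blocks , _) = ⊥-elim (¬Blocks₂ (blocks zeros))
  where
  ¬Blocks₂ : {w : Vec Bit 2} → ¬ Blocks w
  ¬Blocks₂ (single ())
classify (suc (suc n)) φ cube@(blocks , injective , preserves)
  with direction (third ∘ φ) (third-sensitivity φ blocks injective preserves)
... | constant zero φ₃≡0 =
  let tail u = third-0 (blocks u) (φ₃≡0 u)
      φ≡ u = proj₁ (proj₂ (tail u))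
      k , t , s = classify n (proj₁ ∘ tail)
        (WordCube-cancel-++ (0b ∷ 1b ∷ []) (proj₁ ∘ tail) φ≡ (proj₂ ∘ proj₂ ∘ tail) cube)
  in 1 ℕ.+ k , short t , SameImage-resp-++ (0b ∷ 1b ∷ []) {χ = resolve t} φ≡ s
classify (suc (suc zero)) φ cube@(blocks , injective , preserves) | constant (suc zero) φ₃≡1 =
  ⊥-elim (¬Blocks₁ (proj₂ (proj₂ (third-1 (blocks zeros) (φ₃≡1 zeros)))))
  where
  ¬Blocks₁ : {w : Vec Bit 0} → ¬ Blocks w
  ¬Blocks₁ ()
classify (suc (suc (suc n))) φ cube@(blocks , injective , preserves) | constant (suc zero) φ₃≡1 =
  let tail u = third-1 (blocks u) (φ₃≡1 u)
      φ≡ u = proj₁ (proj₂ (tail u))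
      k , t , s = classify n (proj₁ ∘ tail)
        (WordCube-cancel-++ (0b ∷ 1b ∷ 1b ∷ []) (proj₁ ∘ tail) φ≡ (proj₂ ∘ proj₂ ∘ tail) cube)
  in 2 ℕ.+ k , long t , SameImage-resp-++ (0b ∷ 1b ∷ 1b ∷ []) {χ = resolve t} φ≡ s
classify (suc (suc n)) φ (blocks , injective , preserves)
  | along insert value cover insert-injective insert-preserves insert-edge
  with swapAt ← (λ w → swapAtThird (blocks _) (blocks _) (preserves (insert-edge {w})) (value 0b w) (value 1b w))
  with n
-- Blocks 01 and 011 with a nonempty remainder take at least six letters, which rules out lengths
-- three, four and five.
... | 0 = ⊥-elim (¬swapped (swapAt zeros))
  where
  ¬swapped : {u v : Vec Bit 3} → ¬ SwapAtThird u v
  ¬swapped ()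
... | 1 = ⊥-elim (¬swapped (swapAt zeros))
  where
  ¬swapped : {u v : Vec Bit 4} → ¬ SwapAtThird u v
  ¬swapped ()
... | 2 = ⊥-elim (¬swapped (swapAt zeros))
  where
  ¬swapped : {u v : Vec Bit 5} → ¬ SwapAtThird u v
  ¬swapped (swapped ())
... | suc (suc (suc n′)) =
  -- The two ends of each swapped edge share the remainder `proj₁ (tail w)`, so classifying the face
  -- `insert 0b` also settles the face `insert 1b`.
  let tail w = swapped-split (swapAt w)
      φ₀≡ w = proj₁ (proj₂ (tail w))
      φ₁≡ w = proj₁ (proj₂ (proj₂ (tail w)))
      k , t , ψ⊆t , t⊆ψ = classify n′ (proj₁ ∘ tail)
        (WordCube-cancel-++ (0b ∷ 1b ∷ 0b ∷ 1b ∷ 1b ∷ []) (proj₁ ∘ tail) φ₀≡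
          (proj₂ ∘ proj₂ ∘ proj₂ ∘ tail)
          ( blocks ∘ insert 0b
          , insert-injective ∘ injective
          , preserves ∘ insert-preserves ))
      φ≡ : ∀ b {w v} → proj₁ (tail w) ≡ resolve t v → φ (insert b w) ≡ resolve (swap t) (b ∷ v)
      φ≡ = λ { zero     {w} e → trans (φ₀≡ w) (cong ((0b ∷ 1b ∷ 0b ∷ 1b ∷ 1b ∷ []) ++_) e)
             ; (suc zero) {w} e → trans (φ₁≡ w) (cong ((0b ∷ 1b ∷ 1b ∷ 0b ∷ 1b ∷ []) ++_) e) }
  in 3 ℕ.+ k , swap t
   , (λ u → let w , u≡ = cover u
                v , e  = ψ⊆t w
            in third (φ u) ∷ v , trans (cong φ u≡) (φ≡ (third (φ u)) e))
   , λ { (b ∷ v) → let w , e = t⊆ψ v in insert b w , sym (φ≡ b (sym e)) }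

-- Induced cubes as images of embeddings of Q m

module _ (G : Graph) (m : ℕ) where
  open Graph G using (V; _~_; finite; order; index)

  private
    module γ = Inverse (proj₂ finite)
    module q = Inverse (proj₂ (finite-vec 2 m))

    index-injective : ∀ {u v} → index u ≡ index v → u ≡ v
    index-injective {u} {v} e =
      trans (sym (γ.strictlyInverseʳ u)) (trans (cong γ.from e) (γ.strictlyInverseʳ v))

    InImage : (Vec Bit m → V) → Fin order → Set
    InImage f i = ∃ λ u → index (f u) ≡ i

    inImage? : ∀ f → Decidable (InImage f)
    inImage? f i = map′
      (λ (c , e) → q.from c , e)
      (λ (u , e) → q.to u , trans (cong (index ∘ f) (q.strictlyInverseʳ u)) e)
      (Finₚ.any? λ c → index (f (q.from c)) Finₚ.≟ i)

    abstract
      image : (Vec Bit m → V) → Subset order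
      image f = Vec.tabulate (does ∘ inImage? f)

      ∈-image⁻ : ∀ f {i} → i ∈ image f → InImage f i
      ∈-image⁻ f {i} i∈ = toWitness {a? = inImage? f i} (subst T
        (trans (sym ([]=⇒lookup i∈))
          (trans (lookup∘tabulate (does ∘ inImage? f) i) (sym (isYes≗does (inImage? f i))))) _)

      ∈-image⁺ : ∀ f {i} → InImage f i → i ∈ image f
      ∈-image⁺ f {i} p = lookup⇒[]= i _
        (trans (lookup∘tabulate (does ∘ inImage? f) i) (dec-true (inImage? f i) p))

    image-induces-cube : ∀ f → (∀ {u v} → f u ≡ f v → u ≡ v) →
                         (∀ {u v} → DifferOnce u v → f u ~ f v) →
                         (∀ {u v} → f u ~ f v → DifferOnce u v) →
                         induced G (image f) ≅ Q m
    image-induces-cube f injective preserves reflects =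
        mk↔ₛ′ (proj₁ ∘ preimage) (λ u → f u , [ ∈-image⁺ f (u , refl) ])
          (λ u → injective (proj₂ (preimage (f u , [ ∈-image⁺ f (u , refl) ]))))
          (λ v → refinement≡ (proj₂ (preimage v)))
      , λ u v → mk⇔
          (λ e → reflects (subst₂ _~_ (sym (proj₂ (preimage u))) (sym (proj₂ (preimage v))) e))
          (λ d → subst₂ _~_ (proj₂ (preimage u)) (proj₂ (preimage v)) (preserves d))
      where
      preimage : (v : [ v ∈ V ∣ index v ∈ image f ]) → ∃ λ u → f u ≡ value v
      preimage (v , [ v∈ ]) =
        -- The membership proof is irrelevant; decidability of membership restores a usable one.
        let u , e = ∈-image⁻ f (recompute (index v ∈? image f) v∈) in u , index-injective e

    module FromIso (S : Subset order) (iso : induced G S ≅ Q m) where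
      private
        module iso = Inverse (proj₁ iso)

      vertex : Vec Bit m → V
      vertex u = value (iso.from u)

      vertex-injective : ∀ {u v} → vertex u ≡ vertex v → u ≡ v
      vertex-injective {u} {v} e =
        trans (sym (iso.strictlyInverseˡ u)) (trans (cong iso.to (refinement≡ e)) (iso.strictlyInverseˡ v))

      vertex-preserves : ∀ {u v} → DifferOnce u v → vertex u ~ vertex v
      vertex-preserves {u} {v} d = Equivalence.from (proj₂ iso _ _)
        (subst₂ DifferOnce (sym (iso.strictlyInverseˡ u)) (sym (iso.strictlyInverseˡ v)) d)

      image-vertex : image vertex ≡ S
      image-vertex = ⊆-antisym ⊆ ⊇
        where
        ∈S : (v : [ v ∈ V ∣ index v ∈ S ]) → index (value v) ∈ S
        ∈S (v , [ v∈ ]) = recompute (index v ∈? S) v∈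

        ⊆ : ∀ {i} → i ∈ image vertex → i ∈ S
        ⊆ i∈ with u , refl ← ∈-image⁻ vertex i∈ = ∈S (iso.from u)

        ⊇ : ∀ {i} → i ∈ S → i ∈ image vertex
        ⊇ {i} i∈ = ∈-image⁺ vertex
          (iso.to v , trans (cong (index ∘ value) (iso.strictlyInverseʳ v)) (γ.strictlyInverseˡ i))
          where
          v : [ v ∈ V ∣ index v ∈ S ]
          v = γ.from i , [ subst (_∈ S) (sym (γ.strictlyInverseˡ i)) i∈ ]

    image-cong : ∀ {f g} → SameImage f g → image f ≡ image g
    image-cong {f} {g} (f⊆g , g⊆f) = ⊆-antisym
      (λ i∈ → let u , e = ∈-image⁻ f i∈ ; v , e′ = f⊆g u in ∈-image⁺ g (v , trans (cong index (sym e′)) e))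
      (λ i∈ → let u , e = ∈-image⁻ g i∈ ; v , e′ = g⊆f u in ∈-image⁺ f (v , trans (cong index (sym e′)) e))

    image-reflects : ∀ {f g} → image f ≡ image g → SameImage f g
    image-reflects {f} {g} e = inside f g e , inside g f (sym e)
      where
      inside : ∀ f g → image f ≡ image g → ∀ u → ∃ λ v → f u ≡ g v
      inside f g e u =
        let v , e′ = ∈-image⁻ g (subst (index (f u) ∈_) e (∈-image⁺ f (u , refl)))
        in v , index-injective (sym e′)

  -- Counts induced cubes by a family of standard embeddings: `reflects` makes their images induced,
  -- `determines` makes the images distinct, and `classified` makes them exhaust all cubes.
  inducedCubes↔ : {A : Set} (f : A → Vec Bit m → V) →
                  (∀ a {u v} → f a u ≡ f a v → u ≡ v) →
                  (∀ a {u v} → DifferOnce u v → f a u ~ f a v) →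
                  (∀ a {u v} → f a u ~ f a v → DifferOnce u v) →
                  (∀ a b → SameImage (f a) (f b) → a ≡ b) →
                  (∀ φ → (∀ {u v} → φ u ≡ φ v → u ≡ v) → (∀ {u v} → DifferOnce u v → φ u ~ φ v) →
                   ∃ λ a → SameImage φ (f a)) →
                  [ S ∈ Subset order ∣ induced G S ≅ Q m ] ↔ A
  inducedCubes↔ {A} f injective preserves reflects determines classified = mk↔ₛ′ to from to∘from from∘to
    where
    abstract
      -- With the isomorphism irrelevant, the chosen parameter depends on `S` alone.
      parametrise : ∀ S → .(induced G S ≅ Q m) → ∃ λ a → image (f a) ≡ S
      parametrise S iso =
        let open FromIso S (recompute (induced G S ≅? Q m) iso)
            a , s = classified vertex vertex-injective vertex-preserves
        in a , trans (sym (image-cong s)) image-vertex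

    to : [ S ∈ Subset order ∣ induced G S ≅ Q m ] → A
    to (S , [ iso ]) = proj₁ (parametrise S iso)

    from : A → [ S ∈ Subset order ∣ induced G S ≅ Q m ]
    from a = image (f a) , [ image-induces-cube (f a) (injective a) (preserves a) (reflects a) ]

    to∘from : ∀ a → to (from a) ≡ a
    to∘from a = unique (parametrise (image (f a))
      (image-induces-cube (f a) (injective a) (preserves a) (reflects a)))
      where
      unique : (p : ∃ λ b → image (f b) ≡ image (f a)) → proj₁ p ≡ a
      unique (b , e) = determines b a (image-reflects e)

    from∘to : ∀ S → from (to S) ≡ S
    from∘to (S , [ iso ]) = refinement≡ (proj₂ (parametrise S iso))

tiling↔ : ∀ n k m → [ S ∈ _ ∣ induced (padovanGraph (suc n) k) S ≅ Q m ] ↔ Tiling n k m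
tiling↔ n k m = inducedCubes↔ (padovanGraph (suc n) k) m place
  (λ t → resolve-injective t ∘ cong value)
  resolve-preserves
  resolve-reflects
  (λ t t′ (t⊆t′ , t′⊆t) → image-determines t t′
    ( (λ u → let v , e = t⊆t′ u in v , cong value e)
    , (λ u → let v , e = t′⊆t u in v , cong value e)))
  cubes
  where
  Vertex : Set
  Vertex = Graph.V (padovanGraph (suc n) k)

  place : Tiling n k m → Vec Bit m → Vertex
  place t u = resolve t u , [ Blocks⇒Padovan (resolve-blocks t u) , resolve-ones t u ]

  vertex-padovan : (v : Vertex) → Padovan (toList (value v)) × ones (value v) ≡ k
  vertex-padovan (w , [ p ]) = recompute (padovan? (toList w) ×-dec (ones w ℕₚ.≟ k)) p

  cubes : ∀ φ → (∀ {u v} → φ u ≡ φ v → u ≡ v) → (∀ {u v} → DifferOnce u v → value (φ u) ∼ value (φ v)) →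
          ∃ λ t → SameImage φ (place t)
  cubes φ injective preserves
    with k′ , t , t⊇ , t⊆ ← classify n (value ∘ φ)
           ( (λ u → Padovan⇒Blocks (value (φ u)) (proj₁ (vertex-padovan (φ u))))
           , injective ∘ refinement≡ , preserves )
    -- Counting the ones in a single word of the cube identifies `k′` with `k`.
    with refl ← trans (sym (proj₂ (vertex-padovan (φ (proj₁ (t⊆ zeros))))))
                      (trans (cong ones (sym (proj₂ (t⊆ zeros)))) (resolve-ones t zeros))
    = t , (λ u → let v , e = t⊇ u in v , refinement≡ e)
        , (λ u → let v , e = t⊆ u in v , refinement≡ e)

-- The recurrence for tilings

-- The inequalities add up over the tiles and hold for each one: the pairs of length and number of
-- ones are (2,1), (3,2) and (5,3).
tiling-bounds : ∀ {n k m} → Tiling n k m → n ℕ.≤ k ℕ.* 2 × k ℕ.* 3 ℕ.≤ n ℕ.* 2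
tiling-bounds end       = ℕ.z≤n , ℕ.z≤n
tiling-bounds (short t) = let p , q = tiling-bounds t in
  ℕₚ.+-monoʳ-≤ 2 p , ℕₚ.+-mono-≤ (ℕₚ.n≤1+n 3) q
tiling-bounds (long t)  = let p , q = tiling-bounds t in
  ℕₚ.+-mono-≤ (ℕₚ.n≤1+n 3) p , ℕₚ.+-monoʳ-≤ 6 q
tiling-bounds (swap t)  = let p , q = tiling-bounds t in
  ℕₚ.+-mono-≤ (ℕₚ.n≤1+n 5) p , ℕₚ.+-mono-≤ (ℕₚ.n≤1+n 9) q

-- Tilings live only in the admissible range, so the switch to `emptyGraph` in `Φ` loses no cube.
tiling-inRange : ∀ {n k m} → Tiling n k m → InRange (suc n) k
tiling-inRange {n} {k} t =
    ℕ.s≤s ℕ.z≤n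
  -- The floor bound comes from the strict form `suc n < suc k * 2`.
  , ℕ.s≤s⁻¹ (m<n*o⇒m/o<n {suc n} {suc k} {2} (ℕ.s≤s (ℕ.s≤s (proj₁ (tiling-bounds t)))))
  , subst (ℕ._≤ (2 ℕ.* suc n ℕ.∸ 2) ℕ./ 3) (m*n/n≡m k 3)
      (/-monoˡ-≤ 3 (subst (k ℕ.* 3 ℕ.≤_) twice (proj₂ (tiling-bounds t))))
  where
  twice : n ℕ.* 2 ≡ 2 ℕ.* suc n ℕ.∸ 2
  twice = cong (ℕ._∸ 2) (ℕₚ.*-comm (suc n) 2)

-- Cardinalities as integer coefficients

infix 4 _HasSize_

_HasSize_ : Set → ℤ → Set
A HasSize a = Σ[ fin ∈ Finite A ] + card fin ≡ a

-- This turns bijections into equations: one type counted in two ways.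
hasSize-unique : ∀ {A a b} → A HasSize a → A HasSize b → a ≡ b
hasSize-unique ((_ , φ) , refl) ((_ , ψ) , refl) = cong +_ (↔⇒≡ (ψ ↔-∘ ↔-sym φ))

hasSize-↔ : ∀ {A B a} → A ↔ B → B HasSize a → A HasSize a
hasSize-↔ φ ((n , ψ) , e) = (n , ψ ↔-∘ φ) , e

hasSize-⊥ : ∀ {A} → ¬ A → A HasSize 0ℤ
hasSize-⊥ ¬a = (0 , mk↔ₛ′ (⊥-elim ∘ ¬a) (λ ()) (λ ()) (⊥-elim ∘ ¬a)) , refl

hasSize-⊎ : ∀ {A B a b} → A HasSize a → B HasSize b → (A ⊎ B) HasSize (a ℤ.+ b)
hasSize-⊎ ((m , φ) , refl) ((n , ψ) , refl) =
  (m ℕ.+ n , (↔-sym Finₚ.+↔⊎ ↔-∘ (φ ⊎-↔ ψ))) , ℤₚ.pos-+ m n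

cubes-size : ∀ {A : Set} G m → [ S ∈ Subset (Graph.order G) ∣ induced G S ≅ Q m ] ↔ A →
             A HasSize + c m G
cubes-size G m φ = hasSize-↔ (↔-sym φ) (inducedCubes m G , refl)

-- When `P` fails, `A` is empty and `emptyGraph` has no cubes, so both counts are 0. An arbitrary
-- decision `P?` lets the conditional reduce by matching.
cubes-size-if : ∀ {A P : Set} G m (P? : Dec P) → (A → P) → A HasSize + c m G →
                A HasSize + c m (if does P? then G else emptyGraph)
cubes-size-if     G m (yes _) _   size = size
cubes-size-if {A} G m (no ¬p) a⇒p _    =
  subst (A HasSize_) (cong +_ (sym (c-vanish {m} emptyGraph ℕ.z≤n))) (hasSize-⊥ (¬p ∘ a⇒p))

tiling-size : ∀ n k m → Tiling n k m HasSize coeff (cubeSeries (suc n) k) m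
tiling-size n k m = cubes-size-if (padovanGraph (suc n) k) m (inRange? (suc n) k) tiling-inRange
  (cubes-size (padovanGraph (suc n) k) m (tiling↔ n k m))

-- The arguments are the exponents of `y`, `z` and `x`, in this order.
Coeffs : Set
Coeffs = ℕ → ℕ → ℕ → ℤ

infix 4 _≐_

_≐_ : Coeffs → Coeffs → Set
f ≐ g = ∀ n k m → f n k m ≡ g n k m

infixl 6 _⊞_

_⊞_ : Coeffs → Coeffs → Coeffs
(f ⊞ g) n k m = f n k m ℤ.+ g n k m

⊟_ : Coeffs → Coeffs
(⊟ f) n k m = ℤ.- f n k m

δ : Coeffs
δ zero    zero    zero    = 1ℤ
δ zero    zero    (suc _) = 0ℤ
δ zero    (suc _) _       = 0ℤ
δ (suc _) _       _       = 0ℤ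

shiftY shiftZ shiftX : Coeffs → Coeffs
shiftY f zero    k m = 0ℤ
shiftY f (suc n) k m = f n k m
shiftZ f n zero    m = 0ℤ
shiftZ f n (suc k) m = f n k m
shiftX f n k zero    = 0ℤ
shiftX f n k (suc m) = f n k m

-- Types counted by `Coeffs`: addition becomes disjoint union, and multiplication by a variable
-- becomes an index shift.
Family : Set₁
Family = ℕ → ℕ → ℕ → Set

data Origin : Family where
  origin : Origin 0 0 0

data ShiftY (A : Family) : Family where
  shift : ∀ {n k m} → A n k m → ShiftY A (suc n) k m

data ShiftZ (A : Family) : Family where
  shift : ∀ {n k m} → A n k m → ShiftZ A n (suc k) m

data ShiftX (A : Family) : Family where
  shift : ∀ {n k m} → A n k m → ShiftX A n k (suc m)

_⊎̇_ : Family → Family → Family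
(A ⊎̇ B) n k m = A n k m ⊎ B n k m

infix 4 _HasSizes_

_HasSizes_ : Family → Coeffs → Set
A HasSizes f = ∀ n k m → A n k m HasSize f n k m

origin-sizes : Origin HasSizes δ
origin-sizes zero    zero    zero    =
  (1 , mk↔ₛ′ (λ _ → zero) (λ _ → origin) (λ { zero → refl }) (λ { origin → refl })) , refl
origin-sizes zero    zero    (suc _) = hasSize-⊥ λ ()
origin-sizes zero    (suc _) _       = hasSize-⊥ λ ()
origin-sizes (suc _) _       _       = hasSize-⊥ λ ()

shiftY-sizes : ∀ {A f} → A HasSizes f → ShiftY A HasSizes shiftY f
shiftY-sizes s zero    k m = hasSize-⊥ λ ()
shiftY-sizes s (suc n) k m =
  hasSize-↔ (mk↔ₛ′ (λ { (shift a) → a }) shift (λ _ → refl) (λ { (shift _) → refl })) (s n k m)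

shiftZ-sizes : ∀ {A f} → A HasSizes f → ShiftZ A HasSizes shiftZ f
shiftZ-sizes s n zero    m = hasSize-⊥ λ ()
shiftZ-sizes s n (suc k) m =
  hasSize-↔ (mk↔ₛ′ (λ { (shift a) → a }) shift (λ _ → refl) (λ { (shift _) → refl })) (s n k m)

shiftX-sizes : ∀ {A f} → A HasSizes f → ShiftX A HasSizes shiftX f
shiftX-sizes s n k zero    = hasSize-⊥ λ ()
shiftX-sizes s n k (suc m) =
  hasSize-↔ (mk↔ₛ′ (λ { (shift a) → a }) shift (λ _ → refl) (λ { (shift _) → refl })) (s n k m)

⊎-sizes : ∀ {A B f g} → A HasSizes f → B HasSizes g → (A ⊎̇ B) HasSizes (f ⊞ g)
⊎-sizes s t n k m = hasSize-⊎ (s n k m) (t n k m)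

-- The tile weights in nested form, y²z(1 + yz(1 + xy²z)). Keeping the factorisation of the
-- denominator makes `firstTile` agree with `acts-denominator` without rearrangement.
FirstTile : Family → Family
FirstTile A =
  ShiftY (ShiftY (ShiftZ (A ⊎̇ ShiftY (ShiftZ (A ⊎̇ ShiftX (ShiftY (ShiftY (ShiftZ A))))))))

firstTile : Coeffs → Coeffs
firstTile f =
  shiftY (shiftY (shiftZ (f ⊞ shiftY (shiftZ (f ⊞ shiftX (shiftY (shiftY (shiftZ f))))))))

firstTile-sizes : ∀ {A f} → A HasSizes f → FirstTile A HasSizes firstTile f
firstTile-sizes s = shiftY-sizes (shiftY-sizes (shiftZ-sizes (⊎-sizes s
  (shiftY-sizes (shiftZ-sizes (⊎-sizes s (shiftX-sizes (shiftY-sizes (shiftY-sizes (shiftZ-sizes s))))))))))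

tiling-uncons : ∀ n k m → Tiling n k m ↔ (Origin ⊎̇ FirstTile Tiling) n k m
tiling-uncons n k m = mk↔ₛ′ to from to∘from from∘to
  where
  to : ∀ {n k m} → Tiling n k m → (Origin ⊎̇ FirstTile Tiling) n k m
  to end       = inj₁ origin
  to (short t) = inj₂ (shift (shift (shift (inj₁ t))))
  to (long t)  = inj₂ (shift (shift (shift (inj₂ (shift (shift (inj₁ t)))))))
  to (swap t)  = inj₂ (shift (shift (shift (inj₂ (shift (shift (inj₂ (shift (shift (shift (shift t)))))))))))

  from : ∀ {n k m} → (Origin ⊎̇ FirstTile Tiling) n k m → Tiling n k m
  from (inj₁ origin) = end
  from (inj₂ (shift (shift (shift (inj₁ t))))) = short t
  from (inj₂ (shift (shift (shift (inj₂ (shift (shift (inj₁ t)))))))) = long t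
  from (inj₂ (shift (shift (shift (inj₂ (shift (shift (inj₂ (shift (shift (shift (shift t)))))))))))) = swap t

  to∘from : ∀ {n k m} (t : (Origin ⊎̇ FirstTile Tiling) n k m) → to (from t) ≡ t
  to∘from (inj₁ origin) = refl
  to∘from (inj₂ (shift (shift (shift (inj₁ t))))) = refl
  to∘from (inj₂ (shift (shift (shift (inj₂ (shift (shift (inj₁ t)))))))) = refl
  to∘from (inj₂ (shift (shift (shift (inj₂ (shift (shift (inj₂ (shift (shift (shift (shift t)))))))))))) = refl

  from∘to : ∀ {n k m} (t : Tiling n k m) → from (to t) ≡ t
  from∘to end       = refl
  from∘to (short t) = refl
  from∘to (long t)  = refl
  from∘to (swap t)  = refl

coeffs : Series → Coeffs
coeffs f n k m = coeff (f n k) m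

-- Factoring y out of the series removes the final 0 of the words.
inverse : Series
inverse n k = cubeSeries (suc n) k

-- Both sides count `Tiling n k m`, the right one after `tiling-uncons` splits off the first tile.
inverse-recurrence : coeffs inverse ≐ δ ⊞ firstTile (coeffs inverse)
inverse-recurrence n k m = hasSize-unique (tiling-size n k m)
  (hasSize-↔ (tiling-uncons n k m) (⊎-sizes origin-sizes (firstTile-sizes tiling-size) n k m))

-- Series as operators on coefficients

∑ℤ-neg : ∀ {n} (t : Fin n → ℤ) → ∑ℤ (ℤ.-_ ∘ t) ≡ ℤ.- ∑ℤ t
∑ℤ-neg {zero}  t = refl
∑ℤ-neg {suc n} t =
  trans (cong (ℤ._+_ (ℤ.- t zero)) (∑ℤ-neg (t ∘ suc))) (sym (ℤₚ.neg-distrib-+ (t zero) (∑ℤ (t ∘ suc))))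

coeff-sum : ∀ {n} (p : Fin n → Polynomial) m → coeff (sumₚ p) m ≡ ∑ℤ λ i → coeff (p i) m
coeff-sum {zero}  p zero    = refl
coeff-sum {zero}  p (suc m) = refl
coeff-sum {suc n} p m       = cong (ℤ._+_ (coeff (p zero) m)) (coeff-sum (p ∘ suc) m)

-- Abstract, so that the sums do not unfold during unification.
abstract
  convolve : (ℕ → ℕ → ℤ) → ℕ → ℤ
  convolve t n = ∑ℤ {suc n} λ i → t (toℕ i) (n ∸ toℕ i)

  coeff-*ₚ : ∀ p q m → coeff (p *ₚ q) m ≡ convolve (λ l r → coeff p l ℤ.* coeff q r) m
  coeff-*ₚ p q m = refl

  coeff-convolve : ∀ (p : ℕ → ℕ → Polynomial) n m →
                   coeff (sumₚ {suc n} λ i → p (toℕ i) (n ∸ toℕ i)) m ≡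
                   convolve (λ i r → coeff (p i r) m) n
  coeff-convolve p n m = coeff-sum {suc n} (λ i → p (toℕ i) (n ∸ toℕ i)) m

  convolve-cong : ∀ {s t} n → (∀ i r → s i r ≡ t i r) → convolve s n ≡ convolve t n
  convolve-cong {s} {t} n e = sum-cong-≗ {suc n}
    {λ i → s (toℕ i) (n ∸ toℕ i)} {λ i → t (toℕ i) (n ∸ toℕ i)} λ i → e (toℕ i) (n ∸ toℕ i)

  convolve-+ : ∀ s t n → convolve (λ i r → s i r ℤ.+ t i r) n ≡ convolve s n ℤ.+ convolve t n
  convolve-+ s t n = ∑-distrib-+ {suc n} (λ i → s (toℕ i) (n ∸ toℕ i)) (λ i → t (toℕ i) (n ∸ toℕ i))

  convolve-neg : ∀ t n → convolve (λ i r → ℤ.- t i r) n ≡ ℤ.- convolve t n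
  convolve-neg t n = ∑ℤ-neg {suc n} λ i → t (toℕ i) (n ∸ toℕ i)

  convolve-0 : ∀ t → convolve t 0 ≡ t 0 0
  convolve-0 t = ℤₚ.+-identityʳ (t 0 0)

  convolve-head : ∀ {t} n → (∀ i r → t (suc i) r ≡ 0ℤ) → convolve t n ≡ t 0 n
  convolve-head {t} n t≡0 = trans
    (cong (ℤ._+_ (t 0 n)) (∑ℤ-zero {n} (λ i → t (suc (toℕ i)) (n ∸ suc (toℕ i))) λ i → t≡0 _ _))
    (ℤₚ.+-identityʳ (t 0 n))

  convolve-tail : ∀ {t} n → (∀ r → t 0 r ≡ 0ℤ) → convolve t (suc n) ≡ convolve (t ∘ suc) n
  convolve-tail {t} n t≡0 = trans
    (cong (ℤ._+ convolve (t ∘ suc) n) (t≡0 (suc n)))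
    (ℤₚ.+-identityˡ (convolve (t ∘ suc) n))

convolve-zero : ∀ {t} n → (∀ i r → t i r ≡ 0ℤ) → convolve t n ≡ 0ℤ
convolve-zero n t≡0 = trans (convolve-head n (t≡0 ∘ suc)) (t≡0 0 n)

infixl 7 _⋆_

-- The Cauchy product in three variables, nested as in the series ring over polynomials.
_⋆_ : Coeffs → Coeffs → Coeffs
(f ⋆ g) n k m =
  convolve (λ i r → convolve (λ j s → convolve (λ l q → f i j l ℤ.* g r s q) m) k) n

coeffs-* : ∀ f g → coeffs (f * g) ≐ coeffs f ⋆ coeffs g
coeffs-* f g n k m = trans
  (coeff-convolve (λ i r → sumₚ {suc k} λ j → f i (toℕ j) *ₚ g r (k ∸ toℕ j)) n m)
  (convolve-cong n λ i r → trans
    (coeff-convolve (λ j s → f i j *ₚ g r s) k m)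
    (convolve-cong k λ j s → coeff-*ₚ (f i j) (g r s) m))

coeffs-1 : coeffs 1# ≐ δ
coeffs-1 zero    zero    zero    = refl
coeffs-1 zero    zero    (suc _) = refl
coeffs-1 zero    (suc _) zero    = refl
coeffs-1 zero    (suc _) (suc _) = refl
coeffs-1 (suc _) _       zero    = refl
coeffs-1 (suc _) _       (suc _) = refl

coeffs-y : coeffs y ≐ shiftY δ
coeffs-y zero          _       zero    = refl
coeffs-y zero          _       (suc _) = refl
coeffs-y (suc zero)    zero    zero    = refl
coeffs-y (suc zero)    zero    (suc _) = refl
coeffs-y (suc zero)    (suc _) zero    = refl
coeffs-y (suc zero)    (suc _) (suc _) = refl
coeffs-y (suc (suc _)) _       zero    = refl
coeffs-y (suc (suc _)) _       (suc _) = refl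

coeffs-z : coeffs z ≐ shiftZ δ
coeffs-z zero    zero          zero    = refl
coeffs-z zero    zero          (suc _) = refl
coeffs-z zero    (suc zero)    zero    = refl
coeffs-z zero    (suc zero)    (suc _) = refl
coeffs-z zero    (suc (suc _)) zero    = refl
coeffs-z zero    (suc (suc _)) (suc _) = refl
coeffs-z (suc _) zero          zero    = refl
coeffs-z (suc _) zero          (suc _) = refl
coeffs-z (suc _) (suc _)       zero    = refl
coeffs-z (suc _) (suc _)       (suc _) = refl

coeffs-x : coeffs x ≐ shiftX δ
coeffs-x zero    zero    zero          = refl
coeffs-x zero    zero    (suc zero)    = refl
coeffs-x zero    zero    (suc (suc _)) = refl
coeffs-x zero    (suc _) zero          = refl
coeffs-x zero    (suc _) (suc _)       = refl
coeffs-x (suc _) _       zero          = refl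
coeffs-x (suc _) _       (suc _)       = refl

⋆-congˡ : ∀ {f f′ g} → f ≐ f′ → f ⋆ g ≐ f′ ⋆ g
⋆-congˡ {g = g} e n k m = convolve-cong n λ i r → convolve-cong k λ j s → convolve-cong m λ l q →
  cong (ℤ._* g r s q) (e i j l)

⊞-⋆ : ∀ f g h → (f ⊞ g) ⋆ h ≐ f ⋆ h ⊞ g ⋆ h
⊞-⋆ f g h n k m =
  trans (convolve-cong n λ i r →
    trans (convolve-cong k λ j s →
      trans (convolve-cong m λ l q → ℤₚ.*-distribʳ-+ (h r s q) (f i j l) (g i j l))
      (convolve-+ _ _ m))
    (convolve-+ _ _ k))
  (convolve-+ _ _ n)

⊟-⋆ : ∀ f g → (⊟ f) ⋆ g ≐ ⊟ (f ⋆ g)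
⊟-⋆ f g n k m =
  trans (convolve-cong n λ i r →
    trans (convolve-cong k λ j s →
      trans (convolve-cong m λ l q → sym (ℤₚ.neg-distribˡ-* (f i j l) (g r s q)))
      (convolve-neg _ m))
    (convolve-neg _ k))
  (convolve-neg _ n)

δ-⋆ : ∀ g → δ ⋆ g ≐ g
δ-⋆ g n k m =
  trans (convolve-head n λ i r → convolve-zero k λ j s → convolve-zero m λ l q → ℤₚ.*-zeroˡ (g r s q))
  (trans (convolve-head k λ j s → convolve-zero m λ l q → ℤₚ.*-zeroˡ (g n s q))
  (trans (convolve-head m λ l q → ℤₚ.*-zeroˡ (g n k q))
  (ℤₚ.*-identityˡ (g n k m))))

-- The term `i = 0` of the outer sum vanishes, and reindexing the others gives the sum for `f` at
-- one degree lower.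
shiftY-⋆ : ∀ f g → shiftY f ⋆ g ≐ shiftY (f ⋆ g)
shiftY-⋆ f g zero    k m = trans (convolve-0 _)
  (convolve-zero k λ j s → convolve-zero m λ l q → ℤₚ.*-zeroˡ (g 0 s q))
shiftY-⋆ f g (suc n) k m = convolve-tail n λ r →
  convolve-zero k λ j s → convolve-zero m λ l q → ℤₚ.*-zeroˡ (g r s q)

shiftZ-⋆ : ∀ f g → shiftZ f ⋆ g ≐ shiftZ (f ⋆ g)
shiftZ-⋆ f g n zero    m = convolve-zero n λ i r → trans (convolve-0 _)
  (convolve-zero m λ l q → ℤₚ.*-zeroˡ (g r 0 q))
shiftZ-⋆ f g n (suc k) m = convolve-cong n λ i r → convolve-tail k λ s →
  convolve-zero m λ l q → ℤₚ.*-zeroˡ (g r s q)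

shiftX-⋆ : ∀ f g → shiftX f ⋆ g ≐ shiftX (f ⋆ g)
shiftX-⋆ f g n k zero    = convolve-zero n λ i r → convolve-zero k λ j s → trans (convolve-0 _)
  (ℤₚ.*-zeroˡ (g r s 0))
shiftX-⋆ f g n k (suc m) = convolve-cong n λ i r → convolve-cong k λ j s → convolve-tail m λ q →
  ℤₚ.*-zeroˡ (g r s q)

shiftY-cong : ∀ {f g} → f ≐ g → shiftY f ≐ shiftY g
shiftY-cong e zero    k m = refl
shiftY-cong e (suc n) k m = e n k m

shiftZ-cong : ∀ {f g} → f ≐ g → shiftZ f ≐ shiftZ g
shiftZ-cong e n zero    m = refl
shiftZ-cong e n (suc k) m = e n k m

shiftX-cong : ∀ {f g} → f ≐ g → shiftX f ≐ shiftX g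
shiftX-cong e n k zero    = refl
shiftX-cong e n k (suc m) = e n k m

infixr 2 _∙_

_∙_ : ∀ {f g h} → f ≐ g → g ≐ h → f ≐ h
(p ∙ q) n k m = trans (p n k m) (q n k m)

-- Requiring L to commute with convolution makes such operators closed under
-- composition without proving that series multiplication is associative.
record ActsAs (f : Series) (L : Coeffs → Coeffs) : Set where
  field
    acts      : ∀ g → coeffs f ⋆ g ≐ L g
    commutes  : ∀ g h → L g ⋆ h ≐ L (g ⋆ h)
    congruent : ∀ {g h} → g ≐ h → L g ≐ L h

open ActsAs

acts-1 : ActsAs 1# id
acts-1 .acts g = ⋆-congˡ coeffs-1 ∙ δ-⋆ g
acts-1 .commutes g h _ _ _ = refl
acts-1 .congruent e = e

acts-y : ActsAs y shiftY
acts-y .acts g = ⋆-congˡ coeffs-y ∙ shiftY-⋆ δ g ∙ shiftY-cong (δ-⋆ g)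
acts-y .commutes = shiftY-⋆
acts-y .congruent = shiftY-cong

acts-z : ActsAs z shiftZ
acts-z .acts g = ⋆-congˡ coeffs-z ∙ shiftZ-⋆ δ g ∙ shiftZ-cong (δ-⋆ g)
acts-z .commutes = shiftZ-⋆
acts-z .congruent = shiftZ-cong

acts-x : ActsAs x shiftX
acts-x .acts g = ⋆-congˡ coeffs-x ∙ shiftX-⋆ δ g ∙ shiftX-cong (δ-⋆ g)
acts-x .commutes = shiftX-⋆
acts-x .congruent = shiftX-cong

-- Writing series for their coefficients, `(f ⋆ g) ⋆ h` is `L g ⋆ h` by the action of `f`, then
-- `L (g ⋆ h)` by `commutes`, then `L (M h)`.
acts-* : ∀ f g {L M} → ActsAs f L → ActsAs g M → ActsAs (f * g) (L ∘ M)
acts-* f g a b .acts h =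
  ⋆-congˡ (coeffs-* f g ∙ a .acts (coeffs g)) ∙ a .commutes (coeffs g) h ∙ a .congruent (b .acts h)
acts-* f g {M = M} a b .commutes h i = a .commutes (M h) i ∙ a .congruent (b .commutes h i)
acts-* f g a b .congruent e = a .congruent (b .congruent e)

⊞-cong : ∀ {f f′ g g′} → f ≐ f′ → g ≐ g′ → f ⊞ g ≐ f′ ⊞ g′
⊞-cong p q n k m = cong₂ ℤ._+_ (p n k m) (q n k m)

⊟-cong : ∀ {f g} → f ≐ g → ⊟ f ≐ ⊟ g
⊟-cong e n k m = cong ℤ.-_ (e n k m)

acts-+ : ∀ f g {L M} → ActsAs f L → ActsAs g M → ActsAs (f + g) (λ h → L h ⊞ M h)
acts-+ f g a b .acts h = ⊞-⋆ (coeffs f) (coeffs g) h ∙ ⊞-cong (a .acts h) (b .acts h)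
acts-+ f g {L} {M} a b .commutes h i =
  ⊞-⋆ (L h) (M h) i ∙ ⊞-cong (a .commutes h i) (b .commutes h i)
acts-+ f g a b .congruent e = ⊞-cong (a .congruent e) (b .congruent e)

acts-neg : ∀ f {L} → ActsAs f L → ActsAs (- f) (λ h → ⊟ L h)
acts-neg f a .acts h = ⊟-⋆ (coeffs f) h ∙ ⊟-cong (a .acts h)
acts-neg f {L} a .commutes h i = ⊟-⋆ (L h) i ∙ ⊟-cong (a .commutes h i)
acts-neg f a .congruent e = ⊟-cong (a .congruent e)

acts-- : ∀ f g {L M} → ActsAs f L → ActsAs g M → ActsAs (f - g) (λ h → L h ⊞ (⊟ M h))
acts-- f g a b = acts-+ f (- g) a (acts-neg g b)

-- Stated for a variable ring, since unfolding the square of a series is expensive.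
module _ {a ℓ} (R : RawRing a ℓ) where
  private
    module R = RawRing R
    open RawSemiringDefinitions R.rawSemiring using () renaming (_^_ to _^ᴿ_)

  square-closed : {Op : Set} (P : R.Carrier → (Op → Op) → Set) →
                  P R.1# id → (∀ f g {L M} → P f L → P g M → P (f R.* g) (L ∘ M)) →
                  ∀ f {L} → P f L → P (f ^ᴿ 2) (L ∘ L)
  square-closed P p₁ p* f p = p* f (f R.* R.1#) p (p* f R.1# p p₁)

acts-² : ∀ f {L} → ActsAs f L → ActsAs (f ^ 2) (L ∘ L)
acts-² = square-closed (ℤ[x] ⟦y,z⟧) ActsAs acts-1 acts-*

-- Here and in theorem5p1, let makes Agda infer the type before comparing it with
-- the expected one; comparing products of series that contain metavariables
-- would unfold them down to integers.
acts-denominator : ActsAs (1# - y ^ 2 * z * (1# + y * z * (1# + x * y ^ 2 * z)))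
                          (λ f → f ⊞ (⊟ firstTile f))
acts-denominator = let
  d = acts-- _ _ acts-1
    (acts-* _ _ (acts-* _ _ (acts-² _ acts-y) acts-z)
      (acts-+ _ _ acts-1
        (acts-* _ _ (acts-* _ _ acts-y acts-z)
          (acts-+ _ _ acts-1
            (acts-* _ _ (acts-* _ _ acts-x (acts-² _ acts-y)) acts-z)))))
  in d

-- The generating function as a quotient

acts⇒inverse : ∀ h {L} → ActsAs h L → L (coeffs inverse) ≐ δ → h * inverse ≈ 1#
acts⇒inverse h a e n k m = trans
  ((coeffs-* h inverse ∙ a .acts (coeffs inverse) ∙ e) n k m)
  (sym (coeffs-1 n k m))

inverse-cancels : coeffs inverse ⊞ (⊟ firstTile (coeffs inverse)) ≐ δ
inverse-cancels n k m = trans (cong (ℤ._- tail) (inverse-recurrence n k m))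
  (trans (ℤₚ.+-assoc (δ n k m) tail (ℤ.- tail))
  (trans (cong (ℤ._+_ (δ n k m)) (ℤₚ.+-inverseʳ tail)) (ℤₚ.+-identityʳ (δ n k m))))
  where
  tail : ℤ
  tail = firstTile (coeffs inverse) n k m

cubeSeries-quotient : cubeSeries ≈ y * inverse
cubeSeries-quotient n k m = trans (shifted n k m)
  (sym ((coeffs-* y inverse ∙ acts-y .acts (coeffs inverse)) n k m))
  where
  shifted : coeffs cubeSeries ≐ shiftY (coeffs inverse)
  -- At `n = 0` the range condition `1 ≤ n` fails, so `Φ 0 k` is `emptyGraph`, matching the zero
  -- constant term in `y`.
  shifted zero    k m = cong +_ (c-vanish {m} emptyGraph ℕ.z≤n)
  shifted (suc n) k m = refl

theorem5p1 : cubeSeries ≈ y ÷ (1# - y ^ 2 * z * (1# + y * z * (1# + x * y ^ 2 * z)))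
theorem5p1 = let isInverse = acts⇒inverse _ acts-denominator inverse-cancels
             in inverse , isInverse , cubeSeries-quotient
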